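{- For odd $k\ge 3$ let $\alpha'_k=\left(\frac{(k-1)(k+1)}{4k^2}\right)^{(k-1)/2}=2^{ -(k-1)}\left(1-\frac1{k^2}\right)^{(k-1)/2}$. Let $k\mathrm{AND}=f_{\{k\},k}:\{ -1,1\}^k\to\{0,1\}$ be the function which is $1$ exactly on the all-ones vector. Then for every odd $k\ge 3$, $\alpha(k\mathrm{AND})=\alpha'_k$, and for every even $k\ge 2$, $\alpha(k\mathrm{AND})=2\alpha'_{k+1}$.
   Context: For $\mathbf b\in\{ -1,1\}^k$, $\mathrm{wt}(\mathbf b)$ is the number of coordinates equal to $1$. For nonempty $S\subseteq[k]=\{1,\dots,k\}$, $f_{S,k}:\{ -1,1\}^k\to\{0,1\}$ is given by $f_{S,k}(\mathbf x)=1$ iff $\mathrm{wt}(\mathbf x)\in S$. $\Delta_k$ is the set of symmetric probability distributions $\mathcal D$ on $\{ -1,1\}^k$ (vectors of equal weight are equiprobable). $\mathrm{Bern}(p)$ is the random variable equal to $1$ with probability $p$ and $-1$ with probability $1-p$; $\odot$ is the coordinatewise product. For $\mathcal D\in\Delta_k$ and $p\in[0,1]$ define $$\lambda_S(\mathcal D,p)=\mathbb E_{\mathbf a\sim\mathcal D,\ \mathbf b\sim \mathrm{Bern}(p)^k}[f_{S,k}(\mathbf a\odot\mathbf b)],\quad \mu(\mathcal D)=\mathbb E_{\mathbf b\sim\mathcal D}[b_1],\quad \beta_S(\mathcal D)=\sup_{p\in[0,1]}\lambda_S(\mathcal D,p),\quad \gamma_S(\mathcal D)=\lambda_S(\mathcal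 D,1).$$ The (sketching approximation) ratio of $f_{S,k}$ is $$\alpha(f_{S,k})=\inf_{\mathcal D_N,\mathcal D_Y\in\Delta_k:\ \mu(\mathcal D_N)=\mu(\mathcal D_Y)}\frac{\beta_S(\mathcal D_N)}{\gamma_S(\mathcal D_Y)},$$ where the ratio is $+\infty$ if $\gamma_S(\mathcal D_Y)=0$. -}

module Defs where

open import Algebra.Definitions.RawSemiring using () renaming (_^_ to pow)
open import Data.Bool.Base using (if_then_else_)
open import Data.Fin.Base using (Fin; zero; toℕ; fromℕ)
open import Data.Fin.Properties using (any?)
open import Data.Fin.Subset using (Subset; _∈_; ⁅_⁆)
open import Data.Fin.Subset.Properties using (_∈?_)
import Data.Integer.Base as ℤ
open import Data.Nat.Base as ℕ using (ℕ; zero; suc; NonZero)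
import Data.Nat.Properties as ℕ
open import Data.Product.Base using (Σ; ∃-syntax; _×_; _,_)
open import Data.Rational.Base as ℚ using (ℚ; 0ℚ; 1ℚ; ½; Positive; ∣_∣)
import Data.Rational.Properties as ℚ
open import Data.Rational.Solver using (module +-*-Solver)
open import Data.Sign.Base as Sign using (Sign)
import Data.Sign.Properties as Sign
open import Data.Vec.Base using (Vec; []; _∷_; count; lookup; zipWith)
open import Relation.Binary.Construct.Add.Supremum.NonStrict using (_≤⁺_)
open import Relation.Binary.PropositionalEquality
  using (_≡_; refl; sym; trans; cong; cong₂; subst; subst₂)
open import Relation.Nullary.Construct.Add.Supremum using (_⁺; ⊤⁺; [_])
open import Relation.Nullary.Decidable.Core using (Dec; does; _×-dec_)
open import Relation.Nullary.Negation.Core using (¬_)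

-- The real numbers, after Cantor: Cauchy sequences of rationals, taken up to
-- the equivalence _≈_ ("the difference tends to 0").

Eventually : (ℕ → Set) → Set
Eventually P = ∃[ N ] (∀ n → N ℕ.≤ n → P n)

IsCauchy : (ℕ → ℚ) → Set
IsCauchy x = ∀ ε → 0ℚ ℚ.< ε →
  ∃[ N ] (∀ m n → N ℕ.≤ m → N ℕ.≤ n → ∣ x m ℚ.- x n ∣ ℚ.< ε)

record ℝ : Set where
  constructor mkℝ
  field
    seq      : ℕ → ℚ
    isCauchy : IsCauchy seq

open ℝ public

infix 4 _≈_ _≤_

_≈_ : ℝ → ℝ → Set
x ≈ y = ∀ ε → 0ℚ ℚ.< ε → Eventually (λ n → ∣ seq x n ℚ.- seq y n ∣ ℚ.< ε)

-- The slack ε makes this the order of the limits, not the eventual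
-- termwise order of the sequences.
_≤_ : ℝ → ℝ → Set
x ≤ y = ∀ ε → 0ℚ ℚ.< ε → Eventually (λ n → seq x n ℚ.≤ seq y n ℚ.+ ε)

abstract
  half-pos : ∀ {ε} → 0ℚ ℚ.< ε → 0ℚ ℚ.< ½ ℚ.* ε
  half-pos {ε} 0<ε = ℚ.positive⁻¹ (½ ℚ.* ε)
    {{ℚ.pos*pos⇒pos ½ ε {{ℚ.positive 0<ε}}}}

  half+half : ∀ ε → ½ ℚ.* ε ℚ.+ ½ ℚ.* ε ≡ ε
  half+half ε = trans (sym (ℚ.*-distribʳ-+ ε ½ ½)) (ℚ.*-identityˡ ε)

  const-cauchy : ∀ q → IsCauchy (λ _ → q)
  const-cauchy q ε 0<ε = 0 , λ _ _ _ _ →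
    subst (λ d → ∣ d ∣ ℚ.< ε) (sym (ℚ.+-inverseʳ q)) 0<ε

  +-cauchy : ∀ x y → IsCauchy x → IsCauchy y → IsCauchy (λ n → x n ℚ.+ y n)
  +-cauchy x y cx cy ε 0<ε
    with cx _ (half-pos 0<ε) | cy _ (half-pos 0<ε)
  ... | N , hx | M , hy = N ℕ.⊔ M , bound
    where
    regroup : ∀ a b c d →
      (a ℚ.- c) ℚ.+ (b ℚ.- d) ≡ (a ℚ.+ b) ℚ.- (c ℚ.+ d)
    regroup = solve 4
      (λ a b c d → (a :- c) :+ (b :- d) := (a :+ b) :- (c :+ d)) refl
      where open +-*-Solver

    bound : ∀ m n → N ℕ.⊔ M ℕ.≤ m → N ℕ.⊔ M ℕ.≤ n →
      ∣ (x m ℚ.+ y m) ℚ.- (x n ℚ.+ y n) ∣ ℚ.< ε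
    bound m n p q = subst₂ ℚ._<_
      (cong ∣_∣ (regroup (x m) (y m) (x n) (y n))) (half+half ε)
      (ℚ.≤-<-trans (ℚ.∣p+q∣≤∣p∣+∣q∣ (x m ℚ.- x n) (y m ℚ.- y n))
        (ℚ.+-mono-<
          (hx m n (ℕ.m⊔n≤o⇒m≤o N M p) (ℕ.m⊔n≤o⇒m≤o N M q))
          (hy m n (ℕ.m⊔n≤o⇒n≤o N M p) (ℕ.m⊔n≤o⇒n≤o N M q))))

  neg-cauchy : ∀ x → IsCauchy x → IsCauchy (λ n → ℚ.- x n)
  neg-cauchy x cx ε 0<ε with cx ε 0<ε
  ... | N , hx = N , λ m n p q → subst (ℚ._< ε)
    (trans (sym (ℚ.∣-p∣≡∣p∣ (x m ℚ.- x n)))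
           (cong ∣_∣ (ℚ.neg-distrib-+ (x m) (ℚ.- x n))))
    (hx m n p q)

  eventually-bounded : ∀ x → IsCauchy x →
    ∃[ B ] (Positive B × Eventually (λ n → ∣ x n ∣ ℚ.≤ B))
  eventually-bounded x cx with cx 1ℚ (ℚ.positive⁻¹ 1ℚ)
  ... | N , hx = ∣ x N ∣ ℚ.+ 1ℚ , pos , N , bound
    where
    pos : Positive (∣ x N ∣ ℚ.+ 1ℚ)
    pos = ℚ.nonNeg+pos⇒pos ∣ x N ∣ {{ℚ.∣-∣-nonNeg (x N)}} 1ℚ

    regroup : ∀ a b → b ℚ.+ (a ℚ.- b) ≡ a
    regroup = solve 2 (λ a b → b :+ (a :- b) := a) refl
      where open +-*-Solver

    bound : ∀ n → N ℕ.≤ n → ∣ x n ∣ ℚ.≤ ∣ x N ∣ ℚ.+ 1ℚ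
    bound n N≤n = subst (ℚ._≤ ∣ x N ∣ ℚ.+ 1ℚ)
      (cong ∣_∣ (regroup (x n) (x N)))
      (ℚ.≤-trans (ℚ.∣p+q∣≤∣p∣+∣q∣ (x N) (x n ℚ.- x N))
        (ℚ.+-monoʳ-≤ ∣ x N ∣ (ℚ.<⇒≤ (hx n N N≤n ℕ.≤-refl))))

  -- δ = ε / (A + B)
  split-ε : ∀ A B ε → Positive A → Positive B → 0ℚ ℚ.< ε →
    ∃[ δ ] (0ℚ ℚ.< δ × A ℚ.* δ ℚ.+ δ ℚ.* B ≡ ε)
  split-ε A B ε A>0 B>0 0<ε = ε ℚ.* i , 0<δ , total-δ
    where
    A+B>0 : Positive (A ℚ.+ B)
    A+B>0 = ℚ.pos+pos⇒pos A {{A>0}} B {{B>0}}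

    i : ℚ
    i = (ℚ.1/ (A ℚ.+ B)) {{ℚ.pos⇒nonZero (A ℚ.+ B) {{A+B>0}}}}

    0<δ : 0ℚ ℚ.< ε ℚ.* i
    0<δ = ℚ.positive⁻¹ (ε ℚ.* i)
      {{ℚ.pos*pos⇒pos ε {{ℚ.positive 0<ε}} i {{ℚ.1/pos⇒pos (A ℚ.+ B) {{A+B>0}}}}}}

    regroup : ∀ a b e i →
      a ℚ.* (e ℚ.* i) ℚ.+ (e ℚ.* i) ℚ.* b ≡ e ℚ.* (i ℚ.* (a ℚ.+ b))
    regroup = solve 4
      (λ a b e i → a :* (e :* i) :+ (e :* i) :* b := e :* (i :* (a :+ b))) refl
      where open +-*-Solver

    total-δ : A ℚ.* (ε ℚ.* i) ℚ.+ (ε ℚ.* i) ℚ.* B ≡ ε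
    total-δ = trans (regroup A B ε i)
      (trans (cong (ε ℚ.*_)
               (ℚ.*-inverseˡ (A ℚ.+ B) {{ℚ.pos⇒nonZero (A ℚ.+ B) {{A+B>0}}}}))
             (ℚ.*-identityʳ ε))

  ∣*∣-< : ∀ {C δ} c d → Positive C → ∣ c ∣ ℚ.≤ C → ∣ d ∣ ℚ.< δ →
    ∣ c ℚ.* d ∣ ℚ.< C ℚ.* δ
  ∣*∣-< {C} {δ} c d C>0 c≤ d< =
    subst (ℚ._< C ℚ.* δ) (sym (ℚ.∣p*q∣≡∣p∣*∣q∣ c d))
      (ℚ.≤-<-trans (ℚ.*-monoʳ-≤-nonNeg ∣ d ∣ {{ℚ.∣-∣-nonNeg d}} c≤)
                   (ℚ.*-monoʳ-<-pos C {{C>0}} d<))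

  *-telescope : ∀ a b c d →
    a ℚ.* (b ℚ.- d) ℚ.+ (a ℚ.- c) ℚ.* d ≡ a ℚ.* b ℚ.- c ℚ.* d
  *-telescope = solve 4
    (λ a b c d → a :* (b :- d) :+ (a :- c) :* d := a :* b :- c :* d) refl
    where open +-*-Solver

  *-close : ∀ {A B δ ε} a b c d → Positive A → Positive B →
    A ℚ.* δ ℚ.+ δ ℚ.* B ≡ ε → ∣ a ∣ ℚ.≤ A → ∣ d ∣ ℚ.≤ B →
    ∣ a ℚ.- c ∣ ℚ.< δ → ∣ b ℚ.- d ∣ ℚ.< δ → ∣ a ℚ.* b ℚ.- c ℚ.* d ∣ ℚ.< ε
  *-close {A} {B} {δ} a b c d A>0 B>0 eq a≤ d≤ ac bd =
    subst₂ ℚ._<_ (cong ∣_∣ (*-telescope a b c d)) eq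
      (ℚ.≤-<-trans (ℚ.∣p+q∣≤∣p∣+∣q∣ (a ℚ.* (b ℚ.- d)) ((a ℚ.- c) ℚ.* d))
        (ℚ.+-mono-< (∣*∣-< a (b ℚ.- d) A>0 a≤ bd)
          (subst₂ ℚ._<_ (cong ∣_∣ (ℚ.*-comm d (a ℚ.- c))) (ℚ.*-comm B δ)
            (∣*∣-< d (a ℚ.- c) B>0 d≤ ac))))

  *-cauchy : ∀ x y → IsCauchy x → IsCauchy y → IsCauchy (λ n → x n ℚ.* y n)
  *-cauchy x y cx cy ε 0<ε =
    let A , A>0 , K , hA = eventually-bounded x cx
        B , B>0 , L , hB = eventually-bounded y cy
        δ , 0<δ , eq = split-ε A B ε A>0 B>0 0<ε
        N , hx = cx δ 0<δ
        M , hy = cy δ 0<δ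
    in (K ℕ.⊔ L) ℕ.⊔ (N ℕ.⊔ M) , λ m n p q →
      let KL≤m = ℕ.m⊔n≤o⇒m≤o (K ℕ.⊔ L) (N ℕ.⊔ M) p
          KL≤n = ℕ.m⊔n≤o⇒m≤o (K ℕ.⊔ L) (N ℕ.⊔ M) q
          NM≤m = ℕ.m⊔n≤o⇒n≤o (K ℕ.⊔ L) (N ℕ.⊔ M) p
          NM≤n = ℕ.m⊔n≤o⇒n≤o (K ℕ.⊔ L) (N ℕ.⊔ M) q
      in *-close (x m) (y m) (x n) (y n) A>0 B>0 eq
        (hA m (ℕ.m⊔n≤o⇒m≤o K L KL≤m)) (hB n (ℕ.m⊔n≤o⇒n≤o K L KL≤n))
        (hx m n (ℕ.m⊔n≤o⇒m≤o N M NM≤m) (ℕ.m⊔n≤o⇒m≤o N M NM≤n))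
        (hy m n (ℕ.m⊔n≤o⇒n≤o N M NM≤m) (ℕ.m⊔n≤o⇒n≤o N M NM≤n))

fromℚ : ℚ → ℝ
fromℚ q = mkℝ (λ _ → q) (const-cauchy q)

0ℝ 1ℝ : ℝ
0ℝ = fromℚ 0ℚ
1ℝ = fromℚ 1ℚ

infixl 6 _+_ _-_
infixl 7 _*_
infix  8 -_

_+_ _*_ : ℝ → ℝ → ℝ
x + y = mkℝ (λ n → seq x n ℚ.+ seq y n)
  (+-cauchy (seq x) (seq y) (isCauchy x) (isCauchy y))
x * y = mkℝ (λ n → seq x n ℚ.* seq y n)
  (*-cauchy (seq x) (seq y) (isCauchy x) (isCauchy y))

-_ : ℝ → ℝ
- x = mkℝ (λ n → ℚ.- seq x n) (neg-cauchy (seq x) (isCauchy x))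

_-_ : ℝ → ℝ → ℝ
x - y = x + (- y)

UnitInterval : ℝ → Set
UnitInterval p = 0ℝ ≤ p × p ≤ 1ℝ

IsSupOn : (ℝ → Set) → (ℝ → ℝ) → ℝ → Set
IsSupOn A f s =
  (∀ p → A p → f p ≤ s) × (∀ u → (∀ p → A p → f p ≤ u) → s ≤ u)

-- ℝ ⁺ is ℝ with +∞ (written ⊤⁺) adjoined on top.
IsInf : (ℝ ⁺ → Set) → ℝ ⁺ → Set
IsInf P i =
  (∀ r → P r → i ≤∞ r) × (∀ l → (∀ r → P r → l ≤∞ r) → l ≤∞ i)
  where
  infix 4 _≤∞_
  _≤∞_ : ℝ ⁺ → ℝ ⁺ → Set
  _≤∞_ = _≤⁺_ _≤_

-- {-1,1}^k, with Sign as {-1,1}.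
Cube : ℕ → Set
Cube k = Vec Sign k

infixl 7 _⊙_

_⊙_ : ∀ {k} → Cube k → Cube k → Cube k
_⊙_ = zipWith Sign._*_

wt : ∀ {k} → Cube k → ℕ
wt = count (Sign._≟ Sign.+)

signℝ : Sign → ℝ
signℝ Sign.+ = 1ℝ
signℝ Sign.- = - 1ℝ

sumCube : ∀ {k} → (Cube k → ℝ) → ℝ
sumCube {zero}  g = g []
sumCube {suc k} g =
  sumCube (λ x → g (Sign.+ ∷ x)) + sumCube (λ x → g (Sign.- ∷ x))

record Δ (k : ℕ) : Set where
  field
    prob        : Cube k → ℝ
    nonNegative : ∀ x → 0ℝ ≤ prob x
    total       : sumCube prob ≈ 1ℝ
    symmetric   : ∀ x y → wt x ≡ wt y → prob x ≈ prob y

open Δ public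

bern : ℝ → Sign → ℝ
bern p Sign.+ = p
bern p Sign.- = 1ℝ - p

bern^ : ∀ {k} → ℝ → Cube k → ℝ
bern^ p []      = 1ℝ
bern^ p (b ∷ x) = bern p b * bern^ p x

-- A subset S of [k] = {1,…,k} is a Subset k in which the index i : Fin k
-- stands for the number suc (toℕ i).
infix 4 _∈[1⋯]_ _∈[1⋯]?_

_∈[1⋯]_ : ∀ {k} → ℕ → Subset k → Set
w ∈[1⋯] S = ∃[ i ] (i ∈ S × suc (toℕ i) ≡ w)

_∈[1⋯]?_ : ∀ {k} (w : ℕ) (S : Subset k) → Dec (w ∈[1⋯] S)
w ∈[1⋯]? S = any? (λ i → (i ∈? S) ×-dec (suc (toℕ i) ℕ.≟ w))

f : ∀ {k} → Subset k → Cube k → ℝ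
f S x = if does (wt x ∈[1⋯]? S) then 1ℝ else 0ℝ

-- The set {k}, so that kAND is f (top k); fromℕ n is the largest index in Fin (suc n).
top : ∀ k .{{_ : NonZero k}} → Subset k
top (suc n) = ⁅ fromℕ n ⁆

λ[_] : ∀ {k} → Subset k → Δ k → ℝ → ℝ
λ[ S ] D p = sumCube λ a → sumCube λ b → (prob D a * bern^ p b) * f S (a ⊙ b)

first : ∀ k .{{_ : NonZero k}} → Fin k
first (suc n) = zero

μ : ∀ {k} .{{_ : NonZero k}} → Δ k → ℝ
μ {k} D = sumCube λ b → prob D b * signℝ (lookup b (first k))

IsBeta : ∀ {k} → Subset k → Δ k → ℝ → Set
IsBeta S D β = IsSupOn UnitInterval (λ[ S ] D) β

γ[_] : ∀ {k} → Subset k → Δ k → ℝ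
γ[ S ] D = λ[ S ] D 1ℝ

data IsQuotient (b c : ℝ) : ℝ ⁺ → Set where
  infinite : c ≈ 0ℝ → IsQuotient b c ⊤⁺
  finite   : ∀ {r} → ¬ (c ≈ 0ℝ) → r * c ≈ b → IsQuotient b c [ r ]

-- The values β_S(D_N) / γ_S(D_Y) over which the infimum is taken.
Ratio : ∀ {k} .{{_ : NonZero k}} → Subset k → ℝ ⁺ → Set
Ratio {k} S r = Σ (Δ k) λ Dᴺ → Σ (Δ k) λ Dʸ → Σ ℝ λ β →
  μ Dᴺ ≈ μ Dʸ × IsBeta S Dᴺ β × IsQuotient β (γ[ S ] Dʸ) r

-- IsApproxRatio S a says α(f_{S,k}) = a.
IsApproxRatio : ∀ {k} .{{_ : NonZero k}} → Subset k → ℝ → Set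
IsApproxRatio S a = IsInf (Ratio S) [ a ]

infixr 8 _^_

_^_ : ℚ → ℕ → ℚ
_^_ = pow ℚ.+-*-rawSemiring

α′ : ∀ k .{{_ : NonZero k}} → ℚ
α′ k = (ℤ.+ ((k ℕ.∸ 1) ℕ.* (k ℕ.+ 1)) ℚ./ (4 ℕ.* k ℕ.^ 2)) ^ ((k ℕ.∸ 1) ℕ./ 2)
  where instance
    k²≢0 : NonZero (k ℕ.^ 2)
    k²≢0 = ℕ.m^n≢0 k 2

    4k²≢0 : NonZero (4 ℕ.* k ℕ.^ 2)
    4k²≢0 = ℕ.m*n≢0 4 (k ℕ.^ 2)

-- The second closed form of α′; the two agree for odd k.
α″ : ∀ k .{{_ : NonZero k}} → ℚ
α″ k = ½ ^ (k ℕ.∸ 1) ℚ.* (1ℚ ℚ.- ℤ.+ 1 ℚ./ (k ℕ.^ 2)) ^ ((k ℕ.∸ 1) ℕ./ 2)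
  where instance
    k²≢0 : NonZero (k ℕ.^ 2)
    k²≢0 = ℕ.m^n≢0 k 2

{-# OPTIONS --safe #-}
module Submission where

-- For kAND only the all-ones vector a ⊙ b counts, so λ(D, p) is the expectation
-- over a ∼ D of p^wt(a) (1 - p)^(k - wt(a)). By symmetry (1 + μ(D)) / 2 is the
-- expectation of wt(a) / k, and it bounds γ(D), with equality for mixtures of
-- the two constant vectors. Hence α is the infimum over D of
-- β(D) / E[wt(a) / k], the value of a game between D and p. In both parities its
-- saddle point has p = (m + 1) / (2m + 1), where k = 2m + 1 or k = 2m: the lower
-- bound on β says that a convex sequence in the weight lies above a chord through
-- two consecutive terms, and the upper bound, for a D supported on the weights
-- m and m + 1, is an instance of AM-GM.

open import Defs hiding (_≤_)
open import Data.Nat.Base using (suc; NonZero; _≤_; _%_)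
open import Data.Product.Base using (_×_)
open import Data.Rational.Base using (1ℚ) renaming (_+_ to _+ℚ_; _*_ to _*ℚ_)
open import Relation.Binary.PropositionalEquality using (_≡_)

open import Algebra.Bundles using (CommutativeRing; CommutativeMonoid)
open import Data.Bool.Base as Bool using (true; false; if_then_else_)
open import Data.Fin.Base using (toℕ; fromℕ)
open import Data.Fin.Properties using (toℕ-fromℕ)
open import Data.Fin.Subset.Properties using (x∈⁅x⁆; x∈⁅y⁆⇒x≡y)
import Data.Integer.Base as ℤ
import Data.Integer.Properties as ℤ
open import Data.Nat.Base as ℕ using (ℕ; zero; _∸_; _≡ᵇ_; z≤n; s≤s)
open import Data.Nat.Combinatorics using (_C_; nCk+nC[k+1]≡[n+1]C[k+1])
open import Data.Nat.DivMod using (_/_; m*n/n≡m; m≡m%n+[m/n]*n)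
import Data.Nat.Properties as ℕ
open import Data.Nat.Solver using () renaming (module +-*-Solver to NatSolver)
open import Data.Product.Base using (Σ; ∃-syntax; _,_; proj₁; proj₂)
open import Data.Rational.Base as ℚ using (ℚ; 0ℚ; ½; ∣_∣; Positive)
  renaming (_≤_ to _≤ℚ_; _<_ to _<ℚ_; _-_ to _-ℚ_; -_ to -ℚ_)
import Data.Rational.Properties as ℚ
open import Data.Rational.Solver using (module +-*-Solver)
import Data.Rational.Unnormalised.Base as ℚᵘ
import Data.Rational.Unnormalised.Properties as ℚᵘ
open import Data.Sign.Base as Sign using (Sign)
import Data.Sign.Properties as Sign
open import Data.Sum.Base using (inj₁; inj₂)
open import Data.Vec.Base using ([]; _∷_)
open import Data.Vec.Properties using (count≤n)
open import Defs using () renaming (_≤_ to _≤ᴿ_)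
open import Relation.Binary.Bundles using (Preorder)
open import Relation.Binary.Construct.Add.Supremum.NonStrict using (_≤⁺_; _≤⊤⁺; [_])
open import Relation.Binary.PropositionalEquality
  using (_≢_; refl; sym; trans; cong; cong₂; subst; subst₂; module ≡-Reasoning)
import Relation.Binary.Reasoning.Base.Double as DoubleReasoning
open import Relation.Nullary.Construct.Add.Supremum using ([_])
open import Relation.Nullary.Decidable using (dec-true; dec-false)
open import Relation.Nullary.Negation.Core using (¬_; contradiction)

open import Algebra.Properties.Monoid.Mult ℚ.+-0-monoid using (×-homo-+)
open import Algebra.Properties.Semiring.Mult (CommutativeRing.semiring ℚ.+-*-commutativeRing)
  using (×1-homo-*)
open import Algebra.Properties.CommutativeSemiring.Exp
  (CommutativeRing.commutativeSemiring ℚ.+-*-commutativeRing) using (^-distrib-*; ^-homo-*)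
open import Algebra.Properties.CommutativeSemigroup
  (CommutativeMonoid.commutativeSemigroup ℚ.+-0-commutativeMonoid)
  using () renaming (interchange to +-interchange)
open import Algebra.Properties.CommutativeSemigroup
  (CommutativeMonoid.commutativeSemigroup ℚ.*-1-commutativeMonoid)
  using () renaming (x∙yz≈y∙xz to *-swap)

-- The optimal p makes the chord proportional to the weight. Consecutive terms of p^w (1 - p)^(k -
-- w) have ratio p / (1 - p), so the chord through w = m and w = m + 1 passes through the origin
-- exactly when p / (1 - p) = (m + 1) / m. Its slope times k is α. Going from k = 2m + 1 to k = 2m
-- divides the terms by 1 - p = m / (2m + 1) and multiplies k by 2m / (2m + 1); this is the factor 2
-- in front of α′ at k + 1. Against a D on a single weight w the best p is w / k. For k = 2m + 1
-- this is the required p at w = m + 1. For k = 2m no weight gives it, so two weights must be mixed.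
-- Real numbers here are Cauchy sequences without a decidable order, and a supremum has to be
-- exhibited. All optimal strategies and values are therefore rational: the inequalities are proved
-- in ℚ and carried over term by term, and the infimum, as well as the supremum for the optimal D_N,
-- is attained.

-- Rational arithmetic and the terms p^w (1 - p)^(k - w)

ι : ℕ → ℚ
ι n = n · 1ℚ
  where open import Algebra.Definitions.RawSemiring ℚ.+-*-rawSemiring using () renaming (_×_ to _·_)

ι-+ : ∀ m n → ι (m ℕ.+ n) ≡ ι m +ℚ ι n
ι-+ = ×-homo-+ 1ℚ

ι-* : ∀ m n → ι (m ℕ.* n) ≡ ι m *ℚ ι n
ι-* = ×1-homo-*

ι-^ : ∀ m n → ι (m ℕ.^ n) ≡ ι m ^ n
ι-^ m zero    = refl
ι-^ m (suc n) = trans (ι-* m (m ℕ.^ n)) (cong (ι m *ℚ_) (ι-^ m n))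

0≤ι : ∀ n → 0ℚ ≤ℚ ι n
0≤ι zero    = ℚ.≤-refl
0≤ι (suc n) = ℚ.+-mono-≤ (ℚ.nonNegative⁻¹ 1ℚ) (0≤ι n)

0<ι : ∀ n .{{_ : NonZero n}} → 0ℚ <ℚ ι n
0<ι (suc n) = ℚ.+-mono-<-≤ (ℚ.positive⁻¹ 1ℚ) (0≤ι n)

ι-mono : ∀ {m n} → m ≤ n → ι m ≤ℚ ι n
ι-mono {n = n} z≤n       = 0≤ι n
ι-mono (s≤s {m} {n} m≤n) = ℚ.+-monoʳ-≤ 1ℚ (ι-mono m≤n)

*-nonNegℚ : ∀ {p q} → 0ℚ ≤ℚ p → 0ℚ ≤ℚ q → 0ℚ ≤ℚ p *ℚ q
*-nonNegℚ {p} {q} 0≤p 0≤q = ℚ.nonNegative⁻¹ (p *ℚ q)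
  {{ℚ.nonNeg*nonNeg⇒nonNeg p {{ℚ.nonNegative 0≤p}} q {{ℚ.nonNegative 0≤q}}}}

*-posℚ : ∀ {p q} → 0ℚ <ℚ p → 0ℚ <ℚ q → 0ℚ <ℚ p *ℚ q
*-posℚ {p} {q} 0<p 0<q = ℚ.positive⁻¹ (p *ℚ q)
  {{ℚ.pos*pos⇒pos p {{ℚ.positive 0<p}} q {{ℚ.positive 0<q}}}}

*-monoʳℚ : ∀ {p q} r → 0ℚ ≤ℚ r → p ≤ℚ q → r *ℚ p ≤ℚ r *ℚ q
*-monoʳℚ r 0≤r = ℚ.*-monoˡ-≤-nonNeg r {{ℚ.nonNegative 0≤r}}

*-cancelˡℚ : ∀ {p q} r → 0ℚ <ℚ r → r *ℚ p ≤ℚ r *ℚ q → p ≤ℚ q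
*-cancelˡℚ r 0<r = ℚ.*-cancelˡ-≤-pos r {{ℚ.positive 0<r}}

^-nonNeg : ∀ {q} n → 0ℚ ≤ℚ q → 0ℚ ≤ℚ q ^ n
^-nonNeg zero    0≤q = ℚ.nonNegative⁻¹ 1ℚ
^-nonNeg (suc n) 0≤q = *-nonNegℚ 0≤q (^-nonNeg n 0≤q)

^-pos : ∀ {q} n → 0ℚ <ℚ q → 0ℚ <ℚ q ^ n
^-pos zero    0<q = ℚ.positive⁻¹ 1ℚ
^-pos (suc n) 0<q = *-posℚ 0<q (^-pos n 0<q)

abstract
  positive-inverse : ∀ {q} → 0ℚ <ℚ q → ∃[ r ] (0ℚ <ℚ r × r *ℚ q ≡ 1ℚ)
  positive-inverse {q} 0<q = ℚ.1/ q , ℚ.positive⁻¹ (ℚ.1/ q) {{ℚ.1/pos⇒pos q}} , ℚ.*-inverseˡ q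
    where instance
      q>0 : Positive q
      q>0 = ℚ.positive 0<q
      q≢0 : ℚ.NonZero q
      q≢0 = ℚ.pos⇒nonZero q

0≤q-p : ∀ {p q} → p ≤ℚ q → 0ℚ ≤ℚ q -ℚ p
0≤q-p {p} {q} p≤q = subst (_≤ℚ q -ℚ p) (ℚ.+-inverseʳ p) (ℚ.+-monoˡ-≤ (-ℚ p) p≤q)

-- The probability that Bern(p)^k takes a given value of weight i.
φℚ : ℕ → ℚ → ℕ → ℚ
φℚ k p i = p ^ i *ℚ (1ℚ -ℚ p) ^ (k ∸ i)

φℚ-nonNeg : ∀ k {p} i → 0ℚ ≤ℚ p → p ≤ℚ 1ℚ → 0ℚ ≤ℚ φℚ k p i
φℚ-nonNeg k i 0≤p p≤1 = *-nonNegℚ (^-nonNeg i 0≤p) (^-nonNeg (k ∸ i) (0≤q-p p≤1))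

1^n≡1 : ∀ n → 1ℚ ^ n ≡ 1ℚ
1^n≡1 zero    = refl
1^n≡1 (suc n) = trans (ℚ.*-identityˡ (1ℚ ^ n)) (1^n≡1 n)

φℚ-one-top : ∀ k → φℚ k 1ℚ k ≡ 1ℚ
φℚ-one-top k = trans (cong (λ j → 1ℚ ^ k *ℚ 0ℚ ^ j) (ℕ.n∸n≡0 k))
  (trans (ℚ.*-identityʳ (1ℚ ^ k)) (1^n≡1 k))

φℚ-one-other : ∀ k w {j} → k ∸ w ≡ suc j → φℚ k 1ℚ w ≡ 0ℚ
φℚ-one-other k w {j} eq = trans (cong (λ j → 1ℚ ^ w *ℚ 0ℚ ^ j) eq)
  (trans (cong (1ℚ ^ w *ℚ_) (ℚ.*-zeroˡ (0ℚ ^ j))) (ℚ.*-zeroʳ (1ℚ ^ w)))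

-- At p = 1 the term is the indicator of w = k, because 0^0 = 1, and this indicator is at most w /
-- k. Averaged over D, it bounds γ by the mean weight over k.
φℚ-one-≤ : ∀ {k w} → w ≤ k → ι k *ℚ φℚ k 1ℚ w ≤ℚ ι w
φℚ-one-≤ {k} {w} w≤k = cases (k ∸ w) refl
  where
  cases : ∀ j → k ∸ w ≡ j → ι k *ℚ φℚ k 1ℚ w ≤ℚ ι w
  cases zero eq = subst (λ v → ι k *ℚ φℚ k 1ℚ v ≤ℚ ι v) (ℕ.≤-antisym (ℕ.m∸n≡0⇒m≤n eq) w≤k)
    (ℚ.≤-reflexive (trans (cong (ι k *ℚ_) (φℚ-one-top k)) (ℚ.*-identityʳ (ι k))))
  cases (suc j) eq = subst (_≤ℚ ι w)
    (sym (trans (cong (ι k *ℚ_) (φℚ-one-other k w eq)) (ℚ.*-zeroʳ (ι k)))) (0≤ι w)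

-- AM-GM over ℚ

square-nonNeg : ∀ x → 0ℚ ≤ℚ x *ℚ x
square-nonNeg x with ℚ.≤-total 0ℚ x
... | inj₁ 0≤x = *-nonNegℚ 0≤x 0≤x
... | inj₂ x≤0 = subst (0ℚ ≤ℚ_) (solve 1 (λ x → (:- x) :* (:- x) := x :* x) refl x)
  (*-nonNegℚ (ℚ.neg-antimono-≤ x≤0) (ℚ.neg-antimono-≤ x≤0))
  where open +-*-Solver

-- By induction: the expression for n + 1 is y times the one for n plus (n + 1) xⁿ (x - y)². No
-- roots are needed, so everything stays in ℚ.
young : ∀ n {x y} → 0ℚ ≤ℚ x → 0ℚ ≤ℚ y →
  0ℚ ≤ℚ y *ℚ y ^ n +ℚ ι n *ℚ (x *ℚ x ^ n) -ℚ ι (suc n) *ℚ y *ℚ x ^ n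
young zero {x} {y} 0≤x 0≤y = ℚ.≤-reflexive (solve 2 (λ x y → con 0ℚ
  := y :* con 1ℚ :+ con 0ℚ :* (x :* con 1ℚ) :- (con 1ℚ :+ con 0ℚ) :* y :* con 1ℚ) refl x y)
  where open +-*-Solver
young (suc n) {x} {y} 0≤x 0≤y = subst (0ℚ ≤ℚ_)
  (solve 5 (λ x y N X Y →
     y :* (y :* Y :+ N :* (x :* X) :- (con 1ℚ :+ N) :* y :* X) :+ ((con 1ℚ :+ N) :* X) :* ((x :- y) :* (x :- y))
     := y :* (y :* Y) :+ (con 1ℚ :+ N) :* (x :* (x :* X)) :- (con 1ℚ :+ (con 1ℚ :+ N)) :* y :* (x :* X))
     refl x y (ι n) (x ^ n) (y ^ n))
  (ℚ.+-mono-≤ (*-nonNegℚ 0≤y (young n 0≤x 0≤y))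
    (*-nonNegℚ (*-nonNegℚ (0≤ι (suc n)) (^-nonNeg n 0≤x)) (square-nonNeg (x -ℚ y))))
  where open +-*-Solver

0≤q-p⇒p≤q : ∀ {p q} → 0ℚ ≤ℚ q -ℚ p → p ≤ℚ q
0≤q-p⇒p≤q {p} {q} h = subst₂ _≤ℚ_ (ℚ.+-identityʳ p)
  (solve 2 (λ p q → p :+ (q :- p) := q) refl p q) (ℚ.+-monoʳ-≤ p h)
  where open +-*-Solver

-- Factors n P S: some list of n nonnegative numbers has product P and sum S.
data Factors : ℕ → ℚ → ℚ → Set where
  none : Factors 0 1ℚ 0ℚ
  cons : ∀ {n a P S} → 0ℚ ≤ℚ a → Factors n P S → Factors (suc n) (a *ℚ P) (a +ℚ S)

repeat : ∀ j {n a P S} → 0ℚ ≤ℚ a → Factors n P S → Factors (j ℕ.+ n) (a ^ j *ℚ P) (ι j *ℚ a +ℚ S)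
repeat zero {n} {a} {P} {S} 0≤a fs = subst₂ (Factors n)
  (sym (ℚ.*-identityˡ P)) (solve 2 (λ a S → S := con 0ℚ :* a :+ S) refl a S) fs
  where open +-*-Solver
repeat (suc j) {n} {a} {P} {S} 0≤a fs = subst₂ (Factors (suc j ℕ.+ n))
  (sym (ℚ.*-assoc a (a ^ j) P))
  (solve 3 (λ a j S → a :+ (j :* a :+ S) := (con 1ℚ :+ j) :* a :+ S) refl a (ι j) S)
  (cons 0≤a (repeat j 0≤a fs))
  where open +-*-Solver

0≤sum : ∀ {n P S} → Factors n P S → 0ℚ ≤ℚ S
0≤sum none          = ℚ.≤-refl
0≤sum (cons 0≤a fs) = ℚ.+-mono-≤ 0≤a (0≤sum fs)

mean : ∀ {n P S} → Factors n P S → ∃[ x ] (0ℚ ≤ℚ x × S ≡ ι n *ℚ x)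
-- The empty list has sum 0, so any nonnegative value serves as its mean.
mean none = 0ℚ , ℚ.≤-refl , refl
mean {suc n} {S = S} fs@(cons _ _) =
  let r , 0<r , rn≡1 = positive-inverse (0<ι (suc n))
  in r *ℚ S , *-nonNegℚ (ℚ.<⇒≤ 0<r) (0≤sum fs) ,
     sym (trans (solve 3 (λ n r s → n :* (r :* s) := (r :* n) :* s) refl (ι (suc n)) r S)
                (trans (cong (_*ℚ S) rn≡1) (ℚ.*-identityˡ S)))
  where open +-*-Solver

-- If x is the mean without the factor a and y the mean with it, then
-- a = (n + 1) y - n x, and Young's inequality gives a xⁿ ≤ yⁿ⁺¹.
am-gm : ∀ {n P S y} → Factors n P S → 0ℚ ≤ℚ y → S ≡ ι n *ℚ y → P ≤ℚ y ^ n
am-gm none _ _ = ℚ.≤-refl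
am-gm {suc n} {y = y} (cons {a = a} {P} {S} 0≤a fs) 0≤y eq =
  let x , 0≤x , S≡nx = mean fs
      a≡ : a ≡ ι (suc n) *ℚ y -ℚ ι n *ℚ x
      a≡ = trans (solve 2 (λ a S → a := (a :+ S) :- S) refl a S) (cong₂ _-ℚ_ eq S≡nx)
  in begin
    a *ℚ P                                        ≤⟨ *-monoʳℚ a 0≤a (am-gm fs 0≤x S≡nx) ⟩
    a *ℚ x ^ n                                    ≡⟨ cong (_*ℚ x ^ n) a≡ ⟩
    (ι (suc n) *ℚ y -ℚ ι n *ℚ x) *ℚ x ^ n         ≤⟨ 0≤q-p⇒p≤q (subst (0ℚ ≤ℚ_)
      (solve 6 (λ x y N M X Y → y :* Y :+ N :* (x :* X) :- M :* y :* X := y :* Y :- (M :* y :- N :* x) :* X)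
        refl x y (ι n) (ι (suc n)) (x ^ n) (y ^ n)) (young n 0≤x 0≤y)) ⟩
    y *ℚ y ^ n                                    ∎
  where
  open +-*-Solver
  open ℚ.≤-Reasoning

^-*₃ : ∀ x y z n → (x *ℚ y *ℚ z) ^ n ≡ x ^ n *ℚ y ^ n *ℚ z ^ n
^-*₃ x y z n = trans (^-distrib-* (x *ℚ y) z n) (cong (_*ℚ z ^ n) (^-distrib-* x y n))

-- The chord inequality in natural numbers

module _ where
  open ℕ.≤-Reasoning

  -- Bernoulli's inequality (1 + 1/m)^(t + 1) ≥ 1 + (t + 1)/m with the denominators cleared. It
  -- serves the weights m + 1 + t.
  above-middle : ∀ m t → m ℕ.^ t ℕ.* (suc m ℕ.+ t) ≤ suc m ℕ.^ suc t
  above-middle m zero = ℕ.≤-reflexive (NatSolver.solve 1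
    (λ m → con 1 :* (con 1 :+ m :+ con 0) := (con 1 :+ m) :* con 1) refl m)
    where open NatSolver
  above-middle m (suc t) = begin
    m ℕ.* m ℕ.^ t ℕ.* (suc m ℕ.+ suc t)
      ≤⟨ ℕ.m≤m+n _ (m ℕ.^ t ℕ.* suc t) ⟩
    m ℕ.* m ℕ.^ t ℕ.* (suc m ℕ.+ suc t) ℕ.+ m ℕ.^ t ℕ.* suc t
      ≡⟨ NatSolver.solve 3 (λ m t x →
           m :* x :* (con 1 :+ m :+ (con 1 :+ t)) :+ x :* (con 1 :+ t)
           := (con 1 :+ m) :* (x :* (con 1 :+ m :+ t))) refl m t (m ℕ.^ t) ⟩
    suc m ℕ.* (m ℕ.^ t ℕ.* (suc m ℕ.+ t))
      ≤⟨ ℕ.*-monoʳ-≤ (suc m) (above-middle m t) ⟩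
    suc m ℕ.* suc m ℕ.^ suc t ∎
    where open NatSolver

  -- Each step trades a factor m + 1 for a factor m while w grows by one, which is allowed because
  -- (m + 1) w ≤ m (w + 1) for w ≤ m. The equation `w + t ≡ m` replaces a subtraction, so that the
  -- induction can shift w.
  below-middle : ∀ m w t → w ℕ.+ t ≡ m → suc m ℕ.^ t ℕ.* w ≤ m ℕ.^ suc t
  below-middle m w zero eq = ℕ.≤-reflexive (trans
    (NatSolver.solve 1 (λ w → con 1 :* w := (w :+ con 0) :* con 1) refl w)
    (cong (ℕ._* 1) eq))
    where open NatSolver
  below-middle m w (suc t) eq = begin
    suc m ℕ.* suc m ℕ.^ t ℕ.* w
      ≡⟨ NatSolver.solve 3 (λ m w x → (con 1 :+ m) :* x :* w := x :* (m :* w :+ w)) refl m w (suc m ℕ.^ t) ⟩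
    suc m ℕ.^ t ℕ.* (m ℕ.* w ℕ.+ w)
      ≤⟨ ℕ.*-monoʳ-≤ (suc m ℕ.^ t) (ℕ.+-monoʳ-≤ (m ℕ.* w) (ℕ.m+n≤o⇒m≤o w (ℕ.≤-reflexive eq))) ⟩
    suc m ℕ.^ t ℕ.* (m ℕ.* w ℕ.+ m)
      ≡⟨ NatSolver.solve 3 (λ m w x → x :* (m :* w :+ m) := m :* (x :* (con 1 :+ w))) refl m w (suc m ℕ.^ t) ⟩
    m ℕ.* (suc m ℕ.^ t ℕ.* suc w)
      ≤⟨ ℕ.*-monoʳ-≤ m (below-middle m (suc w) t (trans (sym (ℕ.+-suc w t)) eq)) ⟩
    m ℕ.* m ℕ.^ suc t ∎
    where open NatSolver

  -- Up to a power of k = 2m + 1, the right-hand side is p^w (1 - p)^j for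
  -- p = (m + 1) / k. It is convex in w, and the left-hand side is its chord
  -- through w = m and w = m + 1.
  chord : ∀ m w j → w ℕ.+ j ≡ suc (2 ℕ.* m) →
    m ℕ.^ m ℕ.* suc m ℕ.^ m ℕ.* w ≤ suc m ℕ.^ w ℕ.* m ℕ.^ j
  chord m w j eq with ℕ.≤-<-connex w m
  ... | inj₁ w≤m = below (m ∸ w) (ℕ.m+[n∸m]≡n w≤m)
    where
    open NatSolver
    below : ∀ t → w ℕ.+ t ≡ m → m ℕ.^ m ℕ.* suc m ℕ.^ m ℕ.* w ≤ suc m ℕ.^ w ℕ.* m ℕ.^ j
    -- Here j = m + 1 + t, and taking out the common factor mᵐ (m + 1)ʷ leaves `below-middle`.
    below t refl = begin
      m ℕ.^ m ℕ.* suc m ℕ.^ (w ℕ.+ t) ℕ.* w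
        ≡⟨ cong (λ x → m ℕ.^ m ℕ.* x ℕ.* w) (ℕ.^-distribˡ-+-* (suc m) w t) ⟩
      m ℕ.^ m ℕ.* (suc m ℕ.^ w ℕ.* suc m ℕ.^ t) ℕ.* w
        ≡⟨ NatSolver.solve 4 (λ a b c w → a :* (b :* c) :* w := a :* b :* (c :* w)) refl
             (m ℕ.^ m) (suc m ℕ.^ w) (suc m ℕ.^ t) w ⟩
      m ℕ.^ m ℕ.* suc m ℕ.^ w ℕ.* (suc m ℕ.^ t ℕ.* w)
        ≤⟨ ℕ.*-monoʳ-≤ (m ℕ.^ m ℕ.* suc m ℕ.^ w) (below-middle m w t refl) ⟩
      m ℕ.^ m ℕ.* suc m ℕ.^ w ℕ.* m ℕ.^ suc t
        ≡⟨ NatSolver.solve 3 (λ a b c → a :* b :* c := b :* (a :* c)) refl (m ℕ.^ m) (suc m ℕ.^ w) (m ℕ.^ suc t) ⟩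
      suc m ℕ.^ w ℕ.* (m ℕ.^ m ℕ.* m ℕ.^ suc t)
        ≡⟨ cong (suc m ℕ.^ w ℕ.*_) (ℕ.^-distribˡ-+-* m m (suc t)) ⟨
      suc m ℕ.^ w ℕ.* m ℕ.^ (m ℕ.+ suc t)
        ≡⟨ cong (λ i → suc m ℕ.^ w ℕ.* m ℕ.^ i) (ℕ.+-cancelˡ-≡ w _ _ (trans
             (NatSolver.solve 2 (λ w t → w :+ (w :+ t :+ (con 1 :+ t)) := con 1 :+ con 2 :* (w :+ t)) refl w t)
             (sym eq))) ⟩
      suc m ℕ.^ w ℕ.* m ℕ.^ j ∎
  ... | inj₂ m<w = above (w ∸ suc m) (ℕ.m+[n∸m]≡n m<w)
    where
    open NatSolver
    above : ∀ t → suc m ℕ.+ t ≡ w → m ℕ.^ m ℕ.* suc m ℕ.^ m ℕ.* w ≤ suc m ℕ.^ w ℕ.* m ℕ.^ j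
    -- Here m = j + t, and taking out the common factor mʲ (m + 1)ᵐ leaves `above-middle`.
    above t refl = begin
      m ℕ.^ m ℕ.* suc m ℕ.^ m ℕ.* (suc m ℕ.+ t)
        ≡⟨ cong (λ i → m ℕ.^ i ℕ.* suc m ℕ.^ m ℕ.* (suc m ℕ.+ t)) m≡j+t ⟩
      m ℕ.^ (j ℕ.+ t) ℕ.* suc m ℕ.^ m ℕ.* (suc m ℕ.+ t)
        ≡⟨ cong (λ x → x ℕ.* suc m ℕ.^ m ℕ.* (suc m ℕ.+ t)) (ℕ.^-distribˡ-+-* m j t) ⟩
      m ℕ.^ j ℕ.* m ℕ.^ t ℕ.* suc m ℕ.^ m ℕ.* (suc m ℕ.+ t)
        ≡⟨ NatSolver.solve 4 (λ a b c w → a :* b :* c :* w := a :* c :* (b :* w)) refl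
             (m ℕ.^ j) (m ℕ.^ t) (suc m ℕ.^ m) (suc m ℕ.+ t) ⟩
      m ℕ.^ j ℕ.* suc m ℕ.^ m ℕ.* (m ℕ.^ t ℕ.* (suc m ℕ.+ t))
        ≤⟨ ℕ.*-monoʳ-≤ (m ℕ.^ j ℕ.* suc m ℕ.^ m) (above-middle m t) ⟩
      m ℕ.^ j ℕ.* suc m ℕ.^ m ℕ.* suc m ℕ.^ suc t
        ≡⟨ NatSolver.solve 4 (λ a b s x → a :* b :* (s :* x) := s :* (b :* x) :* a) refl
             (m ℕ.^ j) (suc m ℕ.^ m) (suc m) (suc m ℕ.^ t) ⟩
      suc m ℕ.* (suc m ℕ.^ m ℕ.* suc m ℕ.^ t) ℕ.* m ℕ.^ j
        ≡⟨ cong (λ x → suc m ℕ.* x ℕ.* m ℕ.^ j) (ℕ.^-distribˡ-+-* (suc m) m t) ⟨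
      suc m ℕ.^ (suc m ℕ.+ t) ℕ.* m ℕ.^ j ∎
      where
      m≡j+t : m ≡ j ℕ.+ t
      m≡j+t = ℕ.+-cancelˡ-≡ (suc m) _ _ (trans
        (NatSolver.solve 1 (λ m → con 1 :+ m :+ m := con 1 :+ con 2 :* m) refl m)
        (trans (sym eq) (NatSolver.solve 3 (λ m t j → con 1 :+ m :+ t :+ j := con 1 :+ m :+ (j :+ t)) refl m t j)))

chordℚ : ∀ m w j → w ℕ.+ j ≡ suc (2 ℕ.* m) →
  ι m ^ m *ℚ ι (suc m) ^ m *ℚ ι w ≤ℚ ι (suc m) ^ w *ℚ ι m ^ j
chordℚ m w j eq = subst₂ _≤ℚ_
  (trans (ι-* (m ℕ.^ m ℕ.* suc m ℕ.^ m) w) (cong (_*ℚ ι w)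
    (trans (ι-* (m ℕ.^ m) (suc m ℕ.^ m)) (cong₂ _*ℚ_ (ι-^ m m) (ι-^ (suc m) m)))))
  (trans (ι-* (suc m ℕ.^ w) (m ℕ.^ j)) (cong₂ _*ℚ_ (ι-^ (suc m) w) (ι-^ m j)))
  (ι-mono (chord m w j eq))

-- The optimal p and the two bounds of the game over ℚ

+-identity-^ : ∀ x n → x ^ (n ℕ.+ 0) ≡ x ^ n
+-identity-^ x n = cong (x ^_) (ℕ.+-identityʳ n)

^-2* : ∀ x n → x ^ (2 ℕ.* n) ≡ x ^ n *ℚ x ^ n
^-2* x n = trans (^-homo-* x n (n ℕ.+ 0)) (cong (x ^ n *ℚ_) (+-identity-^ x n))

ι-2* : ∀ n → ι (2 ℕ.* n) ≡ ι n +ℚ ι n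
ι-2* n = trans (ι-+ n (n ℕ.+ 0)) (cong (λ j → ι n +ℚ ι j) (ℕ.+-identityʳ n))

-- The optimal p, and α′ₖ = A^m for k = 2m + 1 and T = 1 / k.
module Optimum (m : ℕ) where
  open +-*-Solver

  M N : ℚ
  M = ι m
  N = ι (suc m)

  0≤M : 0ℚ ≤ℚ M
  0≤M = 0≤ι m

  0<N : 0ℚ <ℚ N
  0<N = 0<ι (suc m)

  inverse : ∃[ r ] (0ℚ <ℚ r × r *ℚ ι (suc (2 ℕ.* m)) ≡ 1ℚ)
  inverse = positive-inverse (0<ι (suc (2 ℕ.* m)))

  T : ℚ
  T = proj₁ inverse

  0<T : 0ℚ <ℚ T
  0<T = proj₁ (proj₂ inverse)

  0≤T : 0ℚ ≤ℚ T
  0≤T = ℚ.<⇒≤ 0<T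

  ιk≡N+M : ι (suc (2 ℕ.* m)) ≡ N +ℚ M
  ιk≡N+M = trans (cong (1ℚ +ℚ_) (ι-2* m))
    (solve 1 (λ M → con 1ℚ :+ (M :+ M) := (con 1ℚ :+ M) :+ M) refl M)

  T[N+M]≡1 : T *ℚ (N +ℚ M) ≡ 1ℚ
  T[N+M]≡1 = trans (cong (T *ℚ_) (sym ιk≡N+M)) (proj₂ (proj₂ inverse))

  -- The ring solver treats `T` as a free variable. Identities that depend on T = 1 / k become
  -- polynomial identities once this factor is inserted or removed by hand.
  insert-1 : ∀ x → x ≡ T *ℚ (N +ℚ M) *ℚ x
  insert-1 x = sym (trans (cong (_*ℚ x) T[N+M]≡1) (ℚ.*-identityˡ x))

  -- `μ̂` is the common value of M p and N (1 - p), the point of equality in AM-GM.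
  p A μ̂ : ℚ
  p = N *ℚ T
  A = M *ℚ N *ℚ (T *ℚ T)
  μ̂ = M *ℚ N *ℚ T

  0≤μ̂ : 0ℚ ≤ℚ μ̂
  0≤μ̂ = *-nonNegℚ (*-nonNegℚ 0≤M (ℚ.<⇒≤ 0<N)) 0≤T

  0≤A : 0ℚ ≤ℚ A
  0≤A = *-nonNegℚ (*-nonNegℚ 0≤M (ℚ.<⇒≤ 0<N)) (*-nonNegℚ 0≤T 0≤T)

  0≤p : 0ℚ ≤ℚ p
  0≤p = *-nonNegℚ (ℚ.<⇒≤ 0<N) 0≤T

  1-p≡MT : 1ℚ -ℚ p ≡ M *ℚ T
  1-p≡MT = trans (cong (_-ℚ p) (sym T[N+M]≡1))
    (solve 3 (λ T N M → T :* (N :+ M) :- N :* T := M :* T) refl T N M)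

  p≤1 : p ≤ℚ 1ℚ
  p≤1 = 0≤q-p⇒p≤q (subst (0ℚ ≤ℚ_) (sym 1-p≡MT) (*-nonNegℚ 0≤M 0≤T))

  A^m : A ^ m ≡ M ^ m *ℚ N ^ m *ℚ (T ^ m *ℚ T ^ m)
  A^m = trans (^-*₃ M N (T *ℚ T) m) (cong (M ^ m *ℚ N ^ m *ℚ_) (^-distrib-* T T m))

  φ-optimal : ∀ k w → w ≤ k → φℚ k p w ≡ N ^ w *ℚ M ^ (k ∸ w) *ℚ T ^ k
  φ-optimal k w w≤k = begin
    (N *ℚ T) ^ w *ℚ (1ℚ -ℚ p) ^ (k ∸ w)
      ≡⟨ cong (λ x → (N *ℚ T) ^ w *ℚ x ^ (k ∸ w)) 1-p≡MT ⟩
    (N *ℚ T) ^ w *ℚ (M *ℚ T) ^ (k ∸ w)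
      ≡⟨ cong₂ _*ℚ_ (^-distrib-* N T w) (^-distrib-* M T (k ∸ w)) ⟩
    N ^ w *ℚ T ^ w *ℚ (M ^ (k ∸ w) *ℚ T ^ (k ∸ w))
      ≡⟨ solve 4 (λ a b c d → a :* b :* (c :* d) := a :* c :* (b :* d)) refl
           (N ^ w) (T ^ w) (M ^ (k ∸ w)) (T ^ (k ∸ w)) ⟩
    N ^ w *ℚ M ^ (k ∸ w) *ℚ (T ^ w *ℚ T ^ (k ∸ w))
      ≡⟨ cong (N ^ w *ℚ M ^ (k ∸ w) *ℚ_) (^-homo-* T w (k ∸ w)) ⟨
    N ^ w *ℚ M ^ (k ∸ w) *ℚ T ^ (w ℕ.+ (k ∸ w))
      ≡⟨ cong (λ i → N ^ w *ℚ M ^ (k ∸ w) *ℚ T ^ i) (ℕ.m+[n∸m]≡n w≤k) ⟩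
    N ^ w *ℚ M ^ (k ∸ w) *ℚ T ^ k ∎
    where open ≡-Reasoning

  -- The chord inequality scaled by T^(2m). The term at p carries one more `T`, which cancels
  -- against `ι k`.
  lower-odd : ∀ w → w ≤ suc (2 ℕ.* m) →
    A ^ m *ℚ ι w ≤ℚ ι (suc (2 ℕ.* m)) *ℚ φℚ (suc (2 ℕ.* m)) p w
  lower-odd w w≤k = begin
    A ^ m *ℚ ι w
      ≡⟨ cong (_*ℚ ι w) A^m ⟩
    M ^ m *ℚ N ^ m *ℚ (T ^ m *ℚ T ^ m) *ℚ ι w
      ≡⟨ solve 4 (λ a b t w → a :* b :* (t :* t) :* w := t :* t :* (a :* b :* w)) refl
           (M ^ m) (N ^ m) (T ^ m) (ι w) ⟩
    T ^ m *ℚ T ^ m *ℚ (M ^ m *ℚ N ^ m *ℚ ι w)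
      ≤⟨ *-monoʳℚ (T ^ m *ℚ T ^ m) (*-nonNegℚ (^-nonNeg m 0≤T) (^-nonNeg m 0≤T))
           (chordℚ m w j (ℕ.m+[n∸m]≡n w≤k)) ⟩
    T ^ m *ℚ T ^ m *ℚ (N ^ w *ℚ M ^ j)
      ≡⟨ insert-1 _ ⟩
    T *ℚ (N +ℚ M) *ℚ (T ^ m *ℚ T ^ m *ℚ (N ^ w *ℚ M ^ j))
      ≡⟨ solve 5 (λ T k t a b → T :* k :* (t :* t :* (a :* b)) := k :* (a :* b :* (T :* (t :* t)))) refl
           T (N +ℚ M) (T ^ m) (N ^ w) (M ^ j) ⟩
    (N +ℚ M) *ℚ (N ^ w *ℚ M ^ j *ℚ (T *ℚ (T ^ m *ℚ T ^ m)))
      ≡⟨ cong₂ (λ k t → k *ℚ (N ^ w *ℚ M ^ j *ℚ (T *ℚ t))) ιk≡N+M (^-2* T m) ⟨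
    ι k *ℚ (N ^ w *ℚ M ^ j *ℚ T ^ k)
      ≡⟨ cong (ι k *ℚ_) (φ-optimal k w w≤k) ⟨
    ι k *ℚ φℚ k p w ∎
    where
    open ℚ.≤-Reasoning
    k j : ℕ
    k = suc (2 ℕ.* m)
    j = k ∸ w

  -- The chord inequality is used for 2m + 1, where the exponent of `M` is one larger than k - w.
  -- The spare `M`, doubled, is exactly `ι k`; this is where the 2 comes from.
  lower-even : ∀ w → w ≤ 2 ℕ.* m →
    (1ℚ +ℚ 1ℚ) *ℚ A ^ m *ℚ ι w ≤ℚ ι (2 ℕ.* m) *ℚ φℚ (2 ℕ.* m) p w
  lower-even w w≤k = begin
    (1ℚ +ℚ 1ℚ) *ℚ A ^ m *ℚ ι w
      ≡⟨ cong (λ x → (1ℚ +ℚ 1ℚ) *ℚ x *ℚ ι w) A^m ⟩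
    (1ℚ +ℚ 1ℚ) *ℚ (M ^ m *ℚ N ^ m *ℚ (T ^ m *ℚ T ^ m)) *ℚ ι w
      ≡⟨ solve 4 (λ a b t w → (con 1ℚ :+ con 1ℚ) :* (a :* b :* (t :* t)) :* w
           := (t :* t :+ t :* t) :* (a :* b :* w)) refl (M ^ m) (N ^ m) (T ^ m) (ι w) ⟩
    (T ^ m *ℚ T ^ m +ℚ T ^ m *ℚ T ^ m) *ℚ (M ^ m *ℚ N ^ m *ℚ ι w)
      ≤⟨ *-monoʳℚ _ (ℚ.+-mono-≤ 0≤T^2m 0≤T^2m)
           (chordℚ m w (suc j) (trans (ℕ.+-suc w j) (cong suc (ℕ.m+[n∸m]≡n w≤k)))) ⟩
    (T ^ m *ℚ T ^ m +ℚ T ^ m *ℚ T ^ m) *ℚ (N ^ w *ℚ (M *ℚ M ^ j))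
      ≡⟨ solve 4 (λ t a M b → (t :* t :+ t :* t) :* (a :* (M :* b)) := (M :+ M) :* (a :* b :* (t :* t))) refl
           (T ^ m) (N ^ w) M (M ^ j) ⟩
    (M +ℚ M) *ℚ (N ^ w *ℚ M ^ j *ℚ (T ^ m *ℚ T ^ m))
      ≡⟨ cong₂ (λ k t → k *ℚ (N ^ w *ℚ M ^ j *ℚ t)) (ι-2* m) (^-2* T m) ⟨
    ι k *ℚ (N ^ w *ℚ M ^ j *ℚ T ^ k)
      ≡⟨ cong (ι k *ℚ_) (φ-optimal k w w≤k) ⟨
    ι k *ℚ φℚ k p w ∎
    where
    open ℚ.≤-Reasoning
    k j : ℕ
    k = 2 ℕ.* m
    j = k ∸ w
    0≤T^2m : 0ℚ ≤ℚ T ^ m *ℚ T ^ m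
    0≤T^2m = *-nonNegℚ (^-nonNeg m 0≤T) (^-nonNeg m 0≤T)

  -- AM-GM for m + 1 factors M q and m factors N (1 - q), all equal to μ̂ at q = p.
  upper-odd : 0ℚ <ℚ M → ∀ q → 0ℚ ≤ℚ q → q ≤ℚ 1ℚ →
    ι (suc (2 ℕ.* m)) *ℚ φℚ (suc (2 ℕ.* m)) q (suc m) ≤ℚ A ^ m *ℚ N
  -- The multiplier turns the left-hand side into a product of AM-GM factors: M^(m + 1) N^m is
  -- shared out among the powers of q and 1 - q, and `T` cancels k.
  upper-odd 0<M q 0≤q q≤1 = *-cancelˡℚ (T *ℚ (M *ℚ M ^ m *ℚ N ^ m))
    (*-posℚ 0<T (*-posℚ (*-posℚ 0<M (^-pos m 0<M)) (^-pos m 0<N))) (begin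
    T *ℚ (M *ℚ M ^ m *ℚ N ^ m) *ℚ (ι k *ℚ φℚ k q (suc m))
      ≡⟨ cong₂ (λ k j → T *ℚ (M *ℚ M ^ m *ℚ N ^ m) *ℚ (k *ℚ (q ^ suc m *ℚ r ^ j)))
           ιk≡N+M (trans (ℕ.m+n∸m≡n m (m ℕ.+ 0)) (ℕ.+-identityʳ m)) ⟩
    T *ℚ (M *ℚ M ^ m *ℚ N ^ m) *ℚ ((N +ℚ M) *ℚ (q *ℚ q ^ m *ℚ r ^ m))
      ≡⟨ solve 8 (λ T M a b k q x y → T :* (M :* a :* b) :* (k :* (q :* x :* y))
           := T :* k :* (M :* q :* (a :* x) :* (b :* y :* con 1ℚ))) refl
           T M (M ^ m) (N ^ m) (N +ℚ M) q (q ^ m) (r ^ m) ⟩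
    T *ℚ (N +ℚ M) *ℚ (M *ℚ q *ℚ (M ^ m *ℚ q ^ m) *ℚ (N ^ m *ℚ r ^ m *ℚ 1ℚ))
      ≡⟨ insert-1 _ ⟨
    M *ℚ q *ℚ (M ^ m *ℚ q ^ m) *ℚ (N ^ m *ℚ r ^ m *ℚ 1ℚ)
      ≡⟨ cong₂ (λ x y → M *ℚ q *ℚ x *ℚ (y *ℚ 1ℚ)) (^-distrib-* M q m) (^-distrib-* N r m) ⟨
    (M *ℚ q) ^ suc m *ℚ ((N *ℚ r) ^ m *ℚ 1ℚ)
      ≤⟨ am-gm factors 0≤μ̂ sum≡ ⟩
    μ̂ *ℚ μ̂ ^ (2 ℕ.* m)
      ≡⟨ cong (μ̂ *ℚ_) (trans (^-2* μ̂ m) (cong₂ _*ℚ_ (^-*₃ M N T m) (^-*₃ M N T m))) ⟩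
    μ̂ *ℚ (M ^ m *ℚ N ^ m *ℚ T ^ m *ℚ (M ^ m *ℚ N ^ m *ℚ T ^ m))
      ≡⟨ solve 6 (λ M N T a b t → M :* N :* T :* (a :* b :* t :* (a :* b :* t))
           := T :* (M :* a :* b) :* (a :* b :* (t :* t) :* N)) refl M N T (M ^ m) (N ^ m) (T ^ m) ⟩
    T *ℚ (M *ℚ M ^ m *ℚ N ^ m) *ℚ (M ^ m *ℚ N ^ m *ℚ (T ^ m *ℚ T ^ m) *ℚ N)
      ≡⟨ cong (λ x → T *ℚ (M *ℚ M ^ m *ℚ N ^ m) *ℚ (x *ℚ N)) A^m ⟨
    T *ℚ (M *ℚ M ^ m *ℚ N ^ m) *ℚ (A ^ m *ℚ N) ∎)
    where
    open ℚ.≤-Reasoning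
    k : ℕ
    k = suc (2 ℕ.* m)
    r : ℚ
    r = 1ℚ -ℚ q

    factors : Factors k ((M *ℚ q) ^ suc m *ℚ ((N *ℚ r) ^ m *ℚ 1ℚ)) (N *ℚ (M *ℚ q) +ℚ (M *ℚ (N *ℚ r) +ℚ 0ℚ))
    factors = repeat (suc m) (*-nonNegℚ 0≤M 0≤q)
      (repeat m (*-nonNegℚ (ℚ.<⇒≤ 0<N) (0≤q-p q≤1)) none)

    -- The multiplicities, `N` for M q and `M` for N (1 - q), are what makes q drop out of the sum.
    sum≡ : N *ℚ (M *ℚ q) +ℚ (M *ℚ (N *ℚ r) +ℚ 0ℚ) ≡ ι k *ℚ μ̂
    sum≡ = trans (solve 3 (λ N M q → N :* (M :* q) :+ (M :* (N :* (con 1ℚ :- q)) :+ con 0ℚ) := M :* N) refl N M q)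
      (trans (insert-1 (M *ℚ N))
        (trans (solve 3 (λ T M N → T :* (N :+ M) :* (M :* N) := (N :+ M) :* (M :* N :* T)) refl T M N)
               (cong (_*ℚ μ̂) (sym ιk≡N+M))))

  -- For k = 2m, the combination of the terms at w = m and w = m + 1 with coefficients N² and M² is
  -- q^m (1 - q)^(m - 1) times this linear function.
  weight : ℚ → ℚ
  weight q = N *ℚ N *ℚ (1ℚ -ℚ q) +ℚ M *ℚ M *ℚ q

-- AM-GM for m = n + 1 factors M q, n factors N (1 - q) and the factor
-- T (N² (1 - q) + M² q), all equal to μ̂ at q = p.
module _ (n : ℕ) where
  open +-*-Solver
  open Optimum (suc n)

  upper-even : ∀ q → 0ℚ ≤ℚ q → q ≤ℚ 1ℚ →
    q *ℚ q ^ n *ℚ (1ℚ -ℚ q) ^ n *ℚ weight q ≤ℚ A ^ suc n *ℚ (N *ℚ (N +ℚ M))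
  upper-even q 0≤q q≤1 = *-cancelˡℚ (T *ℚ (M *ℚ M ^ n *ℚ N ^ n))
    (*-posℚ 0<T (*-posℚ (*-posℚ 0<M (^-pos n 0<M)) (^-pos n 0<N))) (begin
    T *ℚ (M *ℚ M ^ n *ℚ N ^ n) *ℚ (q *ℚ q ^ n *ℚ r ^ n *ℚ weight q)
      ≡⟨ solve 8 (λ T M a b q x y w → T :* (M :* a :* b) :* (q :* x :* y :* w)
           := M :* q :* (a :* x) :* (T :* w :* (b :* y :* con 1ℚ))) refl
           T M (M ^ n) (N ^ n) q (q ^ n) (r ^ n) (weight q) ⟩
    M *ℚ q *ℚ (M ^ n *ℚ q ^ n) *ℚ (T *ℚ weight q *ℚ (N ^ n *ℚ r ^ n *ℚ 1ℚ))
      ≡⟨ cong₂ (λ x y → M *ℚ q *ℚ x *ℚ (T *ℚ weight q *ℚ (y *ℚ 1ℚ))) (^-distrib-* M q n) (^-distrib-* N r n) ⟨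
    (M *ℚ q) ^ suc n *ℚ (T *ℚ weight q *ℚ ((N *ℚ r) ^ n *ℚ 1ℚ))
      ≤⟨ am-gm factors 0≤μ̂ sum≡ ⟩
    μ̂ ^ (2 ℕ.* suc n)
      ≡⟨ trans (^-2* μ̂ (suc n)) (cong₂ _*ℚ_ (^-*₃ M N T (suc n)) (^-*₃ M N T (suc n))) ⟩
    M ^ suc n *ℚ N ^ suc n *ℚ T ^ suc n *ℚ (M ^ suc n *ℚ N ^ suc n *ℚ T ^ suc n)
      ≡⟨ insert-1 _ ⟩
    T *ℚ (N +ℚ M) *ℚ (M ^ suc n *ℚ N ^ suc n *ℚ T ^ suc n *ℚ (M ^ suc n *ℚ N ^ suc n *ℚ T ^ suc n))
      ≡⟨ solve 7 (λ M N T k a b t →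
           T :* k :* (M :* a :* (N :* b) :* (T :* t) :* (M :* a :* (N :* b) :* (T :* t)))
           := T :* (M :* a :* b) :* (M :* a :* (N :* b) :* (T :* t :* (T :* t)) :* (N :* k)))
           refl M N T (N +ℚ M) (M ^ n) (N ^ n) (T ^ n) ⟩
    T *ℚ (M *ℚ M ^ n *ℚ N ^ n) *ℚ (M ^ suc n *ℚ N ^ suc n *ℚ (T ^ suc n *ℚ T ^ suc n) *ℚ (N *ℚ (N +ℚ M)))
      ≡⟨ cong (λ x → T *ℚ (M *ℚ M ^ n *ℚ N ^ n) *ℚ (x *ℚ (N *ℚ (N +ℚ M)))) A^m ⟨
    T *ℚ (M *ℚ M ^ n *ℚ N ^ n) *ℚ (A ^ suc n *ℚ (N *ℚ (N +ℚ M))) ∎)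
    where
    open ℚ.≤-Reasoning
    r : ℚ
    r = 1ℚ -ℚ q

    0<M : 0ℚ <ℚ M
    0<M = 0<ι (suc n)

    0≤r : 0ℚ ≤ℚ r
    0≤r = 0≤q-p q≤1

    0≤weight : 0ℚ ≤ℚ weight q
    0≤weight = ℚ.+-mono-≤ (*-nonNegℚ (square-nonNeg N) 0≤r) (*-nonNegℚ (square-nonNeg M) 0≤q)

    factors : Factors (2 ℕ.* suc n) ((M *ℚ q) ^ suc n *ℚ (T *ℚ weight q *ℚ ((N *ℚ r) ^ n *ℚ 1ℚ)))
      (M *ℚ (M *ℚ q) +ℚ (T *ℚ weight q +ℚ (ι n *ℚ (N *ℚ r) +ℚ 0ℚ)))
    factors = repeat (suc n) (*-nonNegℚ 0≤M 0≤q)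
      (cons (*-nonNegℚ 0≤T 0≤weight) (repeat n (*-nonNegℚ (ℚ.<⇒≤ 0<N) 0≤r) none))

    sum≡ : M *ℚ (M *ℚ q) +ℚ (T *ℚ weight q +ℚ (ι n *ℚ (N *ℚ r) +ℚ 0ℚ)) ≡ ι (2 ℕ.* suc n) *ℚ μ̂
    sum≡ = begin-equality
      M *ℚ (M *ℚ q) +ℚ (T *ℚ weight q +ℚ (ι n *ℚ (N *ℚ r) +ℚ 0ℚ))
        ≡⟨ solve 5 (λ M q w n v → M :* (M :* q) :+ (w :+ (n :* v :+ con 0ℚ))
             := w :+ (M :* (M :* q) :+ n :* v)) refl M q (T *ℚ weight q) (ι n) (N *ℚ r) ⟩
      T *ℚ weight q +ℚ (M *ℚ (M *ℚ q) +ℚ ι n *ℚ (N *ℚ r))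
        -- With the factor T (N + M) on the second summand everything is a multiple of `T`; q then
        -- cancels because M² - n N = 1 and N² - M² = N + M.
        ≡⟨ cong (T *ℚ weight q +ℚ_) (insert-1 _) ⟩
      T *ℚ weight q +ℚ T *ℚ (N +ℚ M) *ℚ (M *ℚ (M *ℚ q) +ℚ ι n *ℚ (N *ℚ r))
        ≡⟨ solve 3 (λ T n q →
             let M = con 1ℚ :+ n
                 N = con 1ℚ :+ M
                 r = con 1ℚ :- q
             in T :* (N :* N :* r :+ M :* M :* q) :+ T :* (N :+ M) :* (M :* (M :* q) :+ n :* (N :* r))
                := (M :+ M) :* (M :* N :* T)) refl T (ι n) q ⟩
      (M +ℚ M) *ℚ μ̂
        ≡⟨ cong (_*ℚ μ̂) (ι-2* (suc n)) ⟨
      ι (2 ℕ.* suc n) *ℚ μ̂ ∎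

-- The closed forms of α′

toℚᵘ-ι : ∀ n → ℚ.toℚᵘ (ι n) ℚᵘ.≃ ℚᵘ.mkℚᵘ (ℤ.+ n) 0
toℚᵘ-ι zero    = ℚᵘ.≃-refl
toℚᵘ-ι (suc n) = ℚᵘ.≃-trans (ℚ.toℚᵘ-homo-+ 1ℚ (ι n))
  (ℚᵘ.≃-trans (ℚᵘ.+-congʳ (ℚ.toℚᵘ 1ℚ) (toℚᵘ-ι n))
    (ℚᵘ.*≡* (cong (λ i → (ℤ.+ 1 ℤ.+ i) ℤ.* ℤ.+ 1) (ℤ.*-identityʳ (ℤ.+ n)))))

-- The quotient is stored in lowest terms. Passing to unnormalised rationals avoids its gcd, since
-- equality there is cross-multiplication.
/-*-ι : ∀ n d .{{_ : NonZero d}} → ℤ.+ n ℚ./ d *ℚ ι d ≡ ι n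
/-*-ι n d@(suc e) = ℚ.toℚᵘ-injective (ℚᵘ.≃-trans (ℚ.toℚᵘ-homo-* (ℤ.+ n ℚ./ d) (ι d))
  (ℚᵘ.≃-trans (ℚᵘ.*-cong (ℚ.toℚᵘ-fromℚᵘ (ℚᵘ.mkℚᵘ (ℤ.+ n) e)) (toℚᵘ-ι d))
    (ℚᵘ.≃-trans (ℚᵘ.*≡* (ℤ.*-assoc (ℤ.+ n) (ℤ.+ d) (ℤ.+ 1))) (ℚᵘ.≃-sym (toℚᵘ-ι n)))))

/-unique : ∀ n d .{{_ : NonZero d}} {x} → x *ℚ ι d ≡ ι n → ℤ.+ n ℚ./ d ≡ x
/-unique n d {x} eq =
  let r , _ , rd≡1 = positive-inverse (0<ι d)
      cancel : ∀ y → y ≡ y *ℚ ι d *ℚ r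
      cancel y = sym (trans (solve 3 (λ y d r → y :* d :* r := r :* d :* y) refl y (ι d) r)
        (trans (cong (_*ℚ y) rd≡1) (ℚ.*-identityˡ y)))
  in trans (cancel (ℤ.+ n ℚ./ d)) (trans (cong (_*ℚ r) (trans (/-*-ι n d) (sym eq))) (sym (cancel x)))
  where open +-*-Solver

module _ (m : ℕ) where
  open +-*-Solver
  open Optimum m
  private
    k : ℕ
    k = suc (2 ℕ.* m)

    exponent : 2 ℕ.* m / 2 ≡ m
    exponent = trans (cong (_/ 2) (ℕ.*-comm 2 m)) (m*n/n≡m m 2)

    instance
      k²≢0 : NonZero (k ℕ.^ 2)
      k²≢0 = ℕ.m^n≢0 k 2

      4k²≢0 : NonZero (4 ℕ.* k ℕ.^ 2)
      4k²≢0 = ℕ.m*n≢0 4 (k ℕ.^ 2)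

    ι-k² : ι (k ℕ.^ 2) ≡ (N +ℚ M) *ℚ ((N +ℚ M) *ℚ 1ℚ)
    ι-k² = trans (ι-^ k 2) (cong (_^ 2) ιk≡N+M)

    -- Both sides are 4 M N, because k - 1 = 2m and k + 1 = 2 (m + 1).
    A-quotient : A *ℚ ι (4 ℕ.* k ℕ.^ 2) ≡ ι (2 ℕ.* m ℕ.* (k ℕ.+ 1))
    A-quotient = begin
      A *ℚ ι (4 ℕ.* k ℕ.^ 2)
        ≡⟨ cong (A *ℚ_) (trans (ι-* 4 (k ℕ.^ 2)) (cong (ι 4 *ℚ_) ι-k²)) ⟩
      A *ℚ (ι 4 *ℚ ((N +ℚ M) *ℚ ((N +ℚ M) *ℚ 1ℚ)))
        ≡⟨ solve 4 (λ M N T f → M :* N :* (T :* T) :* (f :* ((N :+ M) :* ((N :+ M) :* con 1ℚ)))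
             := T :* (N :+ M) :* (T :* (N :+ M) :* (f :* (M :* N)))) refl M N T (ι 4) ⟩
      T *ℚ (N +ℚ M) *ℚ (T *ℚ (N +ℚ M) *ℚ (ι 4 *ℚ (M *ℚ N)))
        ≡⟨ insert-1 _ ⟨
      T *ℚ (N +ℚ M) *ℚ (ι 4 *ℚ (M *ℚ N))
        ≡⟨ insert-1 _ ⟨
      ι 4 *ℚ (M *ℚ N)
        ≡⟨ solve 1 (λ M → con (ι 4) :* (M :* (con 1ℚ :+ M))
             := (M :+ M) :* ((con 1ℚ :+ M) :+ M :+ (con 1ℚ :+ con 0ℚ))) refl M ⟩
      (M +ℚ M) *ℚ (N +ℚ M +ℚ ι 1)
        ≡⟨ cong₂ _*ℚ_ (ι-2* m) (trans (ι-+ k 1) (cong (_+ℚ ι 1) ιk≡N+M)) ⟨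
      ι (2 ℕ.* m) *ℚ ι (k ℕ.+ 1)
        ≡⟨ ι-* (2 ℕ.* m) (k ℕ.+ 1) ⟨
      ι (2 ℕ.* m ℕ.* (k ℕ.+ 1)) ∎
      where open ≡-Reasoning

    1/k² : ℤ.+ 1 ℚ./ (k ℕ.^ 2) ≡ T *ℚ T
    1/k² = /-unique 1 (k ℕ.^ 2) (begin
      T *ℚ T *ℚ ι (k ℕ.^ 2)
        ≡⟨ cong (T *ℚ T *ℚ_) ι-k² ⟩
      T *ℚ T *ℚ ((N +ℚ M) *ℚ ((N +ℚ M) *ℚ 1ℚ))
        ≡⟨ solve 3 (λ M N T → T :* T :* ((N :+ M) :* ((N :+ M) :* con 1ℚ))
             := T :* (N :+ M) :* (T :* (N :+ M) :* con 1ℚ)) refl M N T ⟩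
      T *ℚ (N +ℚ M) *ℚ (T *ℚ (N +ℚ M) *ℚ 1ℚ)
        ≡⟨ insert-1 _ ⟨
      T *ℚ (N +ℚ M) *ℚ 1ℚ
        ≡⟨ insert-1 _ ⟨
      1ℚ ∎)
      where open ≡-Reasoning

  α′≡A^m : α′ k ≡ A ^ m
  α′≡A^m = cong₂ _^_ (/-unique (2 ℕ.* m ℕ.* (k ℕ.+ 1)) (4 ℕ.* k ℕ.^ 2) A-quotient) exponent

  α″≡A^m : α″ k ≡ A ^ m
  α″≡A^m = begin
    ½ ^ (2 ℕ.* m) *ℚ (1ℚ -ℚ ℤ.+ 1 ℚ./ (k ℕ.^ 2)) ^ (2 ℕ.* m / 2)
      ≡⟨ cong₂ _*ℚ_ (trans (^-2* ½ m) (sym (^-distrib-* ½ ½ m)))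
                    (cong₂ (λ x i → (1ℚ -ℚ x) ^ i) 1/k² exponent) ⟩
    (½ *ℚ ½) ^ m *ℚ (1ℚ -ℚ T *ℚ T) ^ m
      ≡⟨ ^-distrib-* (½ *ℚ ½) (1ℚ -ℚ T *ℚ T) m ⟨
    (½ *ℚ ½ *ℚ (1ℚ -ℚ T *ℚ T)) ^ m
      ≡⟨ cong (_^ m) quarter ⟩
    A ^ m ∎
    where
    open ≡-Reasoning
    -- Writing 1 as (T k)² turns the bracket into T² (k² - 1), and k² - 1 = 4 M N.
    quarter : ½ *ℚ ½ *ℚ (1ℚ -ℚ T *ℚ T) ≡ A
    quarter = begin
      ½ *ℚ ½ *ℚ (1ℚ -ℚ T *ℚ T)
        ≡⟨ cong (λ x → ½ *ℚ ½ *ℚ (x -ℚ T *ℚ T)) (trans (insert-1 1ℚ)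
             (cong (T *ℚ (N +ℚ M) *ℚ_) (insert-1 1ℚ))) ⟩
      ½ *ℚ ½ *ℚ (T *ℚ (N +ℚ M) *ℚ (T *ℚ (N +ℚ M) *ℚ 1ℚ) -ℚ T *ℚ T)
        ≡⟨ solve 2 (λ T M → let N = con 1ℚ :+ M in
             con ½ :* con ½ :* (T :* (N :+ M) :* (T :* (N :+ M) :* con 1ℚ) :- T :* T)
             := M :* N :* (T :* T)) refl T M ⟩
      A ∎

-- The ordered ring of reals

both : ∀ {P Q R : ℕ → Set} → (∀ {n} → P n → Q n → R n) →
  Eventually P → Eventually Q → Eventually R
both f (N , p) (M , q) = N ℕ.⊔ M , λ n h →
  f (p n (ℕ.m⊔n≤o⇒m≤o N M h)) (q n (ℕ.m⊔n≤o⇒n≤o N M h))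

eventually-map : ∀ {P Q : ℕ → Set} → (∀ {n} → P n → Q n) → Eventually P → Eventually Q
eventually-map f (N , p) = N , λ n h → f (p n h)

always : ∀ {P : ℕ → Set} → (∀ n → P n) → Eventually P
always p = 0 , λ n _ → p n

<⇒half< : ∀ {ε} → 0ℚ <ℚ ε → ½ *ℚ ε <ℚ ε
<⇒half< {ε} 0<ε = subst₂ _<ℚ_ (ℚ.+-identityʳ (½ *ℚ ε)) (half+half ε)
  (ℚ.+-monoʳ-< (½ *ℚ ε) (half-pos 0<ε))

p≤∣p∣ : ∀ p → p ≤ℚ ∣ p ∣
p≤∣p∣ p with ℚ.≤-total 0ℚ p
... | inj₁ 0≤p = ℚ.≤-reflexive (sym (ℚ.0≤p⇒∣p∣≡p 0≤p))
... | inj₂ p≤0 = ℚ.≤-trans p≤0 (ℚ.0≤∣p∣ p)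

∣p-q∣≡∣q-p∣ : ∀ p q → ∣ p -ℚ q ∣ ≡ ∣ q -ℚ p ∣
∣p-q∣≡∣q-p∣ p q = trans (sym (ℚ.∣-p∣≡∣p∣ (p -ℚ q))) (cong ∣_∣ (flip p q))
  where
  open +-*-Solver
  flip : ∀ p q → -ℚ (p -ℚ q) ≡ q -ℚ p
  flip = solve 2 (λ p q → :- (p :- q) := q :- p) refl

p≤q+∣p-q∣ : ∀ p q → p ≤ℚ q +ℚ ∣ p -ℚ q ∣
p≤q+∣p-q∣ p q = subst (_≤ℚ q +ℚ ∣ p -ℚ q ∣) (regroup p q) (ℚ.+-monoʳ-≤ q (p≤∣p∣ (p -ℚ q)))
  where
  open +-*-Solver
  regroup : ∀ p q → q +ℚ (p -ℚ q) ≡ p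
  regroup = solve 2 (λ p q → q :+ (p :- q) := p) refl

p≤q+r⇒p-q≤r : ∀ {p q r} → p ≤ℚ q +ℚ r → p -ℚ q ≤ℚ r
p≤q+r⇒p-q≤r {p} {q} {r} h = subst (p -ℚ q ≤ℚ_) (regroup q r) (ℚ.+-monoˡ-≤ (-ℚ q) h)
  where
  open +-*-Solver
  regroup : ∀ q r → q +ℚ r -ℚ q ≡ r
  regroup = solve 2 (λ q r → q :+ r :- q := r) refl

∣p-q∣≤r : ∀ {p q r} → p ≤ℚ q +ℚ r → q ≤ℚ p +ℚ r → ∣ p -ℚ q ∣ ≤ℚ r
∣p-q∣≤r {p} {q} {r} p≤ q≤ with ℚ.∣p∣≡p∨∣p∣≡-p (p -ℚ q)
... | inj₁ eq = subst (_≤ℚ r) (sym eq) (p≤q+r⇒p-q≤r p≤)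
... | inj₂ eq = subst (_≤ℚ r) (trans (flip q p) (sym eq)) (p≤q+r⇒p-q≤r q≤)
  where
  open +-*-Solver
  flip : ∀ q p → q -ℚ p ≡ -ℚ (p -ℚ q)
  flip = solve 2 (λ q p → q :- p := :- (p :- q)) refl

∣-∣-triangle : ∀ {ε} p q r → ∣ p -ℚ q ∣ <ℚ ½ *ℚ ε → ∣ q -ℚ r ∣ <ℚ ½ *ℚ ε → ∣ p -ℚ r ∣ <ℚ ε
∣-∣-triangle {ε} p q r h k = subst₂ _<ℚ_ (cong ∣_∣ (regroup p q r)) (half+half ε)
  (ℚ.≤-<-trans (ℚ.∣p+q∣≤∣p∣+∣q∣ (p -ℚ q) (q -ℚ r)) (ℚ.+-mono-< h k))
  where
  open +-*-Solver
  regroup : ∀ p q r → (p -ℚ q) +ℚ (q -ℚ r) ≡ p -ℚ r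
  regroup = solve 3 (λ p q r → (p :- q) :+ (q :- r) := p :- r) refl

-- The relations of Defs unfold to Π-types, from which Agda cannot recover
-- the two reals; wrapped in records, they can be inferred.
infix 4 _≃_ _≲_

record _≃_ (x y : ℝ) : Set where
  constructor ⦅_⦆
  field unwrap : x ≈ y

record _≲_ (x y : ℝ) : Set where
  constructor ⦅_⦆
  field unwrap : x ≤ᴿ y

open _≃_ using () renaming (unwrap to un≃)
open _≲_ using () renaming (unwrap to un≲)

pointwise-≃ : ∀ {x y} → (∀ n → seq x n ≡ seq y n) → x ≃ y
pointwise-≃ {x} {y} eq = ⦅ (λ ε 0<ε → always λ n → subst (_<ℚ ε)
  (cong ∣_∣ (sym (trans (cong (_-ℚ seq y n) (eq n)) (ℚ.+-inverseʳ (seq y n))))) 0<ε) ⦆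

eventually-≲ : ∀ {x y} → Eventually (λ n → seq x n ≤ℚ seq y n) → x ≲ y
eventually-≲ {x} {y} le = ⦅ (λ ε 0<ε → eventually-map
  (λ {n} xₙ≤yₙ → subst (_≤ℚ seq y n +ℚ ε) (ℚ.+-identityʳ _) (ℚ.+-mono-≤ xₙ≤yₙ (ℚ.<⇒≤ 0<ε)))
  le) ⦆

pointwise-≲ : ∀ {x y} → (∀ n → seq x n ≤ℚ seq y n) → x ≲ y
pointwise-≲ le = eventually-≲ (always le)

≃-refl : ∀ {x} → x ≃ x
≃-refl = pointwise-≃ λ _ → refl

≃-sym : ∀ {x y} → x ≃ y → y ≃ x
≃-sym {x} {y} ⦅ h ⦆ = ⦅ (λ ε 0<ε → eventually-map
  (λ {n} → subst (_<ℚ ε) (∣p-q∣≡∣q-p∣ (seq x n) (seq y n))) (h ε 0<ε)) ⦆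

≃-trans : ∀ {x y z} → x ≃ y → y ≃ z → x ≃ z
≃-trans {x} {y} {z} ⦅ h ⦆ ⦅ k ⦆ = ⦅ (λ ε 0<ε → both
  (λ {n} → ∣-∣-triangle (seq x n) (seq y n) (seq z n))
  (h _ (half-pos 0<ε)) (k _ (half-pos 0<ε))) ⦆

≃⇒≲ : ∀ {x y} → x ≃ y → x ≲ y
≃⇒≲ {x} {y} ⦅ h ⦆ = ⦅ (λ ε 0<ε → eventually-map
  (λ {n} d → ℚ.≤-trans (p≤q+∣p-q∣ (seq x n) (seq y n)) (ℚ.+-monoʳ-≤ (seq y n) (ℚ.<⇒≤ d)))
  (h ε 0<ε)) ⦆

≲-trans : ∀ {x y z} → x ≲ y → y ≲ z → x ≲ z
≲-trans {x} {y} {z} ⦅ h ⦆ ⦅ k ⦆ = ⦅ (λ ε 0<ε → both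
  (λ {n} p q → ℚ.≤-trans p (subst (seq y n +ℚ ½ *ℚ ε ≤ℚ_)
    (trans (ℚ.+-assoc (seq z n) _ _) (cong (seq z n +ℚ_) (half+half ε)))
    (ℚ.+-monoˡ-≤ (½ *ℚ ε) q)))
  (h _ (half-pos 0<ε)) (k _ (half-pos 0<ε))) ⦆

≲-antisym : ∀ {x y} → x ≲ y → y ≲ x → x ≃ y
≲-antisym {x} {y} ⦅ h ⦆ ⦅ k ⦆ = ⦅ (λ ε 0<ε → both
  (λ p q → ℚ.≤-<-trans (∣p-q∣≤r p q) (<⇒half< 0<ε))
  (h _ (half-pos 0<ε)) (k _ (half-pos 0<ε))) ⦆

≲-preorder : Preorder _ _ _
≲-preorder = record
  { Carrier = ℝ ; _≈_ = _≃_ ; _≲_ = _≲_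
  ; isPreorder = record
    { isEquivalence = record { refl = ≃-refl ; sym = ≃-sym ; trans = ≃-trans }
    ; reflexive = ≃⇒≲ ; trans = ≲-trans } }

open DoubleReasoning (Preorder.isPreorder ≲-preorder)

≲-refl : ∀ {x} → x ≲ x
≲-refl = ≃⇒≲ ≃-refl

+-cong : ∀ {x x′ y y′} → x ≃ x′ → y ≃ y′ → x + y ≃ x′ + y′
+-cong {x} {x′} {y} {y′} ⦅ h ⦆ ⦅ k ⦆ = ⦅ (λ ε 0<ε → both
  (λ {n} p q → subst₂ _<ℚ_
    (cong ∣_∣ (regroup (seq x n) (seq y n) (seq x′ n) (seq y′ n))) (half+half ε)
    (ℚ.≤-<-trans (ℚ.∣p+q∣≤∣p∣+∣q∣ (seq x n -ℚ seq x′ n) (seq y n -ℚ seq y′ n))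
      (ℚ.+-mono-< p q)))
  (h _ (half-pos 0<ε)) (k _ (half-pos 0<ε))) ⦆
  where
  open +-*-Solver
  regroup : ∀ a b c d → (a -ℚ c) +ℚ (b -ℚ d) ≡ (a +ℚ b) -ℚ (c +ℚ d)
  regroup = solve 4 (λ a b c d → (a :- c) :+ (b :- d) := (a :+ b) :- (c :+ d)) refl

*-cong : ∀ {x x′ y y′} → x ≃ x′ → y ≃ y′ → x * y ≃ x′ * y′
*-cong {x} {x′} {y} {y′} ⦅ h ⦆ ⦅ k ⦆ = ⦅ (λ ε 0<ε →
  let A , A>0 , hA = eventually-bounded (seq x) (isCauchy x)
      B , B>0 , hB = eventually-bounded (seq y′) (isCauchy y′)
      δ , 0<δ , eq = split-ε A B ε A>0 B>0 0<ε
  in both (λ {n} (a , d) (p , q) →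
       *-close (seq x n) (seq y n) (seq x′ n) (seq y′ n) A>0 B>0 eq a d p q)
     (both _,_ hA hB) (both _,_ (h δ 0<δ) (k δ 0<δ))) ⦆

+-mono-≲ : ∀ {x x′ y y′} → x ≲ x′ → y ≲ y′ → x + y ≲ x′ + y′
+-mono-≲ {x} {x′} {y} {y′} ⦅ h ⦆ ⦅ k ⦆ = ⦅ (λ ε 0<ε → both
  (λ {n} p q → subst (seq x n +ℚ seq y n ≤ℚ_)
    (trans (+-interchange (seq x′ n) (½ *ℚ ε) (seq y′ n) (½ *ℚ ε))
           (cong ((seq x′ n +ℚ seq y′ n) +ℚ_) (half+half ε)))
    (ℚ.+-mono-≤ p q))
  (h _ (half-pos 0<ε)) (k _ (half-pos 0<ε))) ⦆

-- A nonnegative real may have negative terms. Truncation gives an equal real whose terms are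
-- nonnegative, so that inequalities of ℚ apply to each of them.
positivePart : ℝ → ℝ
positivePart x = mkℝ (λ n → 0ℚ ℚ.⊔ seq x n) λ ε 0<ε →
  let N , h = isCauchy x ε 0<ε
  in N , λ m n N≤m N≤n → ℚ.≤-<-trans (contract (seq x m) (seq x n)) (h m n N≤m N≤n)
  where
  oneSided : ∀ a b → 0ℚ ℚ.⊔ a ≤ℚ 0ℚ ℚ.⊔ b +ℚ ∣ a -ℚ b ∣
  oneSided a b = ℚ.⊔-lub
    (ℚ.+-mono-≤ (ℚ.p≤p⊔q 0ℚ b) (ℚ.0≤∣p∣ (a -ℚ b)))
    (ℚ.≤-trans (p≤q+∣p-q∣ a b) (ℚ.+-monoˡ-≤ ∣ a -ℚ b ∣ (ℚ.p≤q⊔p 0ℚ b)))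

  contract : ∀ a b → ∣ (0ℚ ℚ.⊔ a) -ℚ (0ℚ ℚ.⊔ b) ∣ ≤ℚ ∣ a -ℚ b ∣
  contract a b = ∣p-q∣≤r (oneSided a b)
    (subst (λ d → 0ℚ ℚ.⊔ b ≤ℚ 0ℚ ℚ.⊔ a +ℚ d) (∣p-q∣≡∣q-p∣ b a) (oneSided b a))

positivePart-≃ : ∀ {x} → 0ℝ ≲ x → positivePart x ≃ x
positivePart-≃ {x} ⦅ h ⦆ = ⦅ (λ ε 0<ε → eventually-map
  (λ {n} p → ℚ.≤-<-trans
    (∣p-q∣≤r
      (ℚ.⊔-lub p (x≤x+half 0<ε (seq x n)))
      (ℚ.≤-trans (ℚ.p≤q⊔p 0ℚ (seq x n)) (x≤x+half 0<ε (0ℚ ℚ.⊔ seq x n))))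
    (<⇒half< 0<ε))
  (h _ (half-pos 0<ε))) ⦆
  where
  x≤x+half : ∀ {ε} → 0ℚ <ℚ ε → ∀ x → x ≤ℚ x +ℚ ½ *ℚ ε
  x≤x+half {ε} 0<ε x = subst (_≤ℚ x +ℚ ½ *ℚ ε) (ℚ.+-identityʳ x)
    (ℚ.+-monoʳ-≤ x (ℚ.<⇒≤ (half-pos 0<ε)))

*-nonNeg : ∀ {x y} → 0ℝ ≲ x → 0ℝ ≲ y → 0ℝ ≲ x * y
*-nonNeg {x} {y} 0≤x 0≤y = begin
  0ℝ                              ≲⟨ pointwise-≲ (λ n → *-nonNegℚ (ℚ.p≤p⊔q 0ℚ (seq x n)) (ℚ.p≤p⊔q 0ℚ (seq y n))) ⟩
  positivePart x * positivePart y ≈⟨ *-cong (positivePart-≃ 0≤x) (positivePart-≃ 0≤y) ⟩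
  x * y                           ∎

x≲y⇒0≲y-x : ∀ {x y} → x ≲ y → 0ℝ ≲ y - x
x≲y⇒0≲y-x {x} {y} x≤y = begin
  0ℝ    ≈⟨ pointwise-≃ (λ n → sym (ℚ.+-inverseʳ (seq x n))) ⟩
  x - x ≲⟨ +-mono-≲ x≤y ≲-refl ⟩
  y - x ∎

0≲y-x⇒x≲y : ∀ {x y} → 0ℝ ≲ y - x → x ≲ y
0≲y-x⇒x≲y {x} {y} h = begin
  x           ≈⟨ pointwise-≃ (λ n → sym (ℚ.+-identityʳ (seq x n))) ⟩
  x + 0ℝ      ≲⟨ +-mono-≲ ≲-refl h ⟩
  x + (y - x) ≈⟨ pointwise-≃ (λ n → cancel (seq x n) (seq y n)) ⟩
  y           ∎
  where
  open +-*-Solver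
  cancel : ∀ a b → a +ℚ (b -ℚ a) ≡ b
  cancel = solve 2 (λ a b → a :+ (b :- a) := b) refl

*-monoʳ-≲ : ∀ {x y z} → 0ℝ ≲ z → x ≲ y → z * x ≲ z * y
*-monoʳ-≲ {x} {y} {z} 0≤z x≤y = 0≲y-x⇒x≲y (begin
  0ℝ            ≲⟨ *-nonNeg 0≤z (x≲y⇒0≲y-x x≤y) ⟩
  z * (y - x)   ≈⟨ pointwise-≃ (λ n → distrib (seq z n) (seq y n) (seq x n)) ⟩
  z * y - z * x ∎)
  where
  open +-*-Solver
  distrib : ∀ a b c → a *ℚ (b -ℚ c) ≡ a *ℚ b -ℚ a *ℚ c
  distrib = solve 3 (λ a b c → a :* (b :- c) := a :* b :- a :* c) refl

neg-cong : ∀ {x y} → x ≃ y → - x ≃ - y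
neg-cong {x} {y} eq = begin-equality
  - x        ≈⟨ neg-as-* x ⟩
  (- 1ℝ) * x ≈⟨ *-cong ≃-refl eq ⟩
  (- 1ℝ) * y ≈⟨ neg-as-* y ⟨
  - y        ∎
  where
  open +-*-Solver
  neg-as-* : ∀ x → - x ≃ (- 1ℝ) * x
  neg-as-* x = pointwise-≃ λ n → solve 1 (λ a → :- a := con (-ℚ 1ℚ) :* a) refl (seq x n)

-- Truncating p at 0, and then 1 - p at 0, clips every term to [0,1]. The supremum in β ranges over
-- real p, and this lets the rational AM-GM bound act on each term.
unit-representative : ∀ {p} → 0ℝ ≲ p → p ≲ 1ℝ →
  ∃[ p′ ] (p ≃ p′ × (∀ n → 0ℚ ≤ℚ seq p′ n) × (∀ n → seq p′ n ≤ℚ 1ℚ))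
unit-representative {p} 0≤p p≤1 = 1ℝ - r , eq , lower , upper
  where
  open +-*-Solver
  p⁺ r : ℝ
  p⁺ = positivePart p
  r  = positivePart (1ℝ - p⁺)

  eq : p ≃ 1ℝ - r
  eq = begin-equality
    p               ≈⟨ positivePart-≃ 0≤p ⟨
    p⁺              ≈⟨ pointwise-≃ (λ n → solve 1 (λ a → a := con 1ℚ :- (con 1ℚ :- a)) refl (seq p⁺ n)) ⟩
    1ℝ - (1ℝ - p⁺)  ≈⟨ +-cong ≃-refl (neg-cong (positivePart-≃ (x≲y⇒0≲y-x
                         (≲-trans (≃⇒≲ (positivePart-≃ 0≤p)) p≤1)))) ⟨
    1ℝ - r          ∎

  lower : ∀ n → 0ℚ ≤ℚ 1ℚ -ℚ seq r n
  lower n = 0≤q-p (ℚ.⊔-lub (ℚ.nonNegative⁻¹ 1ℚ)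
    (subst (1ℚ -ℚ seq p⁺ n ≤ℚ_) (ℚ.+-identityʳ 1ℚ)
      (ℚ.+-monoʳ-≤ 1ℚ (ℚ.neg-antimono-≤ (ℚ.p≤p⊔q 0ℚ (seq p n))))))

  upper : ∀ n → 1ℚ -ℚ seq r n ≤ℚ 1ℚ
  upper n = subst (1ℚ -ℚ seq r n ≤ℚ_) (ℚ.+-identityʳ 1ℚ)
    (ℚ.+-monoʳ-≤ 1ℚ (ℚ.neg-antimono-≤ (ℚ.p≤p⊔q 0ℚ (1ℚ -ℚ seq p⁺ n))))

-- Constructively z ≉ 0 does not give a positive lower bound for z. But the
-- goal 0 ≤ d only fails if some rational η > 0 has d + η ≤ 0, and then z = 0.
*-cancel-nonNeg : ∀ {d z} → 0ℝ ≲ z → ¬ (z ≈ 0ℝ) → 0ℝ ≲ d * z → 0ℝ ≲ d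
*-cancel-nonNeg {d} {z} 0≤z z≉0 0≤dz = ⦅ bound ⦆
  where
  open +-*-Solver
  z≲0 : ∀ η → 0ℚ <ℚ η → d + fromℚ η ≲ 0ℝ → z ≲ 0ℝ
  z≲0 η 0<η d+η≤0 =
    let r , 0<r , rη≡1 = positive-inverse 0<η
        ηz≲0 : fromℚ η * z ≲ 0ℝ
        ηz≲0 = begin
          fromℚ η * z            ≈⟨ pointwise-≃ (λ n → ℚ.+-identityˡ _) ⟨
          0ℝ + fromℚ η * z       ≲⟨ +-mono-≲ 0≤dz ≲-refl ⟩
          d * z + fromℚ η * z    ≈⟨ pointwise-≃ (λ n → solve 3 (λ d e z → d :* z :+ e :* z := z :* (d :+ e)) refl (seq d n) η (seq z n)) ⟩
          z * (d + fromℚ η)      ≲⟨ *-monoʳ-≲ 0≤z d+η≤0 ⟩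
          z * 0ℝ                 ≈⟨ pointwise-≃ (λ n → ℚ.*-zeroʳ (seq z n)) ⟩
          0ℝ                     ∎
    in begin
      z                       ≈⟨ pointwise-≃ (λ n → ℚ.*-identityˡ (seq z n)) ⟨
      1ℝ * z                  ≈⟨ pointwise-≃ (λ n → cong (_*ℚ seq z n) rη≡1) ⟨
      fromℚ (r *ℚ η) * z      ≈⟨ pointwise-≃ (λ n → ℚ.*-assoc r η (seq z n)) ⟩
      fromℚ r * (fromℚ η * z) ≲⟨ *-monoʳ-≲ (pointwise-≲ λ _ → ℚ.<⇒≤ 0<r) ηz≲0 ⟩
      fromℚ r * 0ℝ            ≈⟨ pointwise-≃ (λ n → ℚ.*-zeroʳ r) ⟩
      0ℝ                      ∎

  bound : 0ℝ ≤ᴿ d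
  bound ε 0<ε with isCauchy d _ (half-pos (half-pos 0<ε))
  -- The sign of one rational is decidable. Terms beyond `N` move by less than ε/4, so it settles
  -- either 0 ≤ d + ε or d + ε/4 ≤ 0 for all of them.
  ... | N , h with ℚ.≤-total 0ℚ (seq d N +ℚ ½ *ℚ ε)
  ... | inj₁ 0≤ = N , λ n N≤n → ℚ.≤-trans 0≤ (ℚ.≤-trans
    (ℚ.+-monoˡ-≤ (½ *ℚ ε) (ℚ.≤-trans (p≤q+∣p-q∣ (seq d N) (seq d n)) (ℚ.+-monoʳ-≤ (seq d n)
      (ℚ.<⇒≤ (ℚ.<-trans (h N n ℕ.≤-refl N≤n) (<⇒half< (half-pos 0<ε)))))))
    (ℚ.≤-reflexive (trans (ℚ.+-assoc (seq d n) _ _) (cong (seq d n +ℚ_) (half+half ε)))))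
  ... | inj₂ ≤0 = contradiction
    (un≃ (≲-antisym (z≲0 _ (half-pos (half-pos 0<ε)) (eventually-≲ (N , λ n N≤n → ℚ.≤-trans
      (ℚ.+-monoˡ-≤ (½ *ℚ (½ *ℚ ε)) (ℚ.≤-trans (p≤q+∣p-q∣ (seq d n) (seq d N))
        (ℚ.+-monoʳ-≤ (seq d N) (ℚ.<⇒≤ (h n N N≤n ℕ.≤-refl)))))
      (ℚ.≤-trans
        (ℚ.≤-reflexive (trans (ℚ.+-assoc (seq d N) _ _) (cong (seq d N +ℚ_) (half+half (½ *ℚ ε)))))
        ≤0)))) 0≤z))
    z≉0

*-cancelʳ-≲ : ∀ {x y z} → 0ℝ ≲ z → ¬ (z ≈ 0ℝ) → x * z ≲ y * z → x ≲ y
*-cancelʳ-≲ {x} {y} {z} 0≤z z≉0 h = 0≲y-x⇒x≲y (*-cancel-nonNeg 0≤z z≉0 (begin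
  0ℝ              ≲⟨ x≲y⇒0≲y-x h ⟩
  y * z - x * z   ≈⟨ pointwise-≃ (λ n → solve 3 (λ y z x → y :* z :- x :* z := (y :- x) :* z) refl (seq y n) (seq z n) (seq x n)) ⟩
  (y - x) * z     ∎))
  where open +-*-Solver

-- Expectations over symmetric distributions

sumCube-cong : ∀ {k} {g h : Cube k → ℝ} → (∀ x → g x ≃ h x) → sumCube g ≃ sumCube h
sumCube-cong {zero}  eq = eq []
sumCube-cong {suc k} eq =
  +-cong (sumCube-cong λ x → eq (Sign.+ ∷ x)) (sumCube-cong λ x → eq (Sign.- ∷ x))

sumCube-mono : ∀ {k} {g h : Cube k → ℝ} → (∀ x → g x ≲ h x) → sumCube g ≲ sumCube h
sumCube-mono {zero}  le = le []
sumCube-mono {suc k} le =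
  +-mono-≲ (sumCube-mono λ x → le (Sign.+ ∷ x)) (sumCube-mono λ x → le (Sign.- ∷ x))

sumCube-zero : ∀ {k} {g : Cube k → ℝ} → (∀ x → g x ≃ 0ℝ) → sumCube g ≃ 0ℝ
sumCube-zero {zero}  eq = eq []
sumCube-zero {suc k} {g} eq = begin-equality
  sumCube g ≈⟨ +-cong (sumCube-zero λ x → eq (Sign.+ ∷ x)) (sumCube-zero λ x → eq (Sign.- ∷ x)) ⟩
  0ℝ + 0ℝ   ≈⟨ pointwise-≃ (λ _ → ℚ.+-identityˡ 0ℚ) ⟩
  0ℝ        ∎

sumCube-+ : ∀ {k} (g h : Cube k → ℝ) → sumCube (λ x → g x + h x) ≃ sumCube g + sumCube h
sumCube-+ {zero}  g h = ≃-refl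
sumCube-+ {suc k} g h = begin-equality
  sumCube (λ x → g x + h x)
    ≈⟨ +-cong (sumCube-+ (λ x → g (Sign.+ ∷ x)) (λ x → h (Sign.+ ∷ x)))
              (sumCube-+ (λ x → g (Sign.- ∷ x)) (λ x → h (Sign.- ∷ x))) ⟩
  (g₊ + h₊) + (g₋ + h₋)
    ≈⟨ pointwise-≃ (λ n → +-interchange (seq g₊ n) (seq h₊ n) (seq g₋ n) (seq h₋ n)) ⟩
  (g₊ + g₋) + (h₊ + h₋) ∎
  where
  g₊ g₋ h₊ h₋ : ℝ
  g₊ = sumCube λ x → g (Sign.+ ∷ x)
  g₋ = sumCube λ x → g (Sign.- ∷ x)
  h₊ = sumCube λ x → h (Sign.+ ∷ x)
  h₋ = sumCube λ x → h (Sign.- ∷ x)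

sumCube-* : ∀ {k} c (g : Cube k → ℝ) → sumCube (λ x → c * g x) ≃ c * sumCube g
sumCube-* {zero}  c g = ≃-refl
sumCube-* {suc k} c g = begin-equality
  sumCube (λ x → c * g x)
    ≈⟨ +-cong (sumCube-* c λ x → g (Sign.+ ∷ x)) (sumCube-* c λ x → g (Sign.- ∷ x)) ⟩
  c * g₊ + c * g₋
    ≈⟨ pointwise-≃ (λ n → ℚ.*-distribˡ-+ (seq c n) (seq g₊ n) (seq g₋ n)) ⟨
  c * (g₊ + g₋) ∎
  where
  g₊ g₋ : ℝ
  g₊ = sumCube λ x → g (Sign.+ ∷ x)
  g₋ = sumCube λ x → g (Sign.- ∷ x)

sumCube-single : ∀ {k} (g : Cube k → ℝ) a → (∀ b → b ≢ a → g b ≃ 0ℝ) → sumCube g ≃ g a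
sumCube-single g [] off = ≃-refl
sumCube-single g (Sign.+ ∷ a) off = begin-equality
  sumCube g ≈⟨ +-cong (sumCube-single (λ x → g (Sign.+ ∷ x)) a (λ b b≢a → off _ λ { refl → b≢a refl }))
                      (sumCube-zero λ x → off (Sign.- ∷ x) λ ()) ⟩
  g _ + 0ℝ  ≈⟨ pointwise-≃ (λ n → ℚ.+-identityʳ _) ⟩
  g _       ∎
sumCube-single g (Sign.- ∷ a) off = begin-equality
  sumCube g ≈⟨ +-cong (sumCube-zero λ x → off (Sign.+ ∷ x) λ ())
                      (sumCube-single (λ x → g (Sign.- ∷ x)) a (λ b b≢a → off _ λ { refl → b≢a refl })) ⟩
  0ℝ + g _  ≈⟨ pointwise-≃ (λ n → ℚ.+-identityˡ _) ⟩
  g _       ∎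

wt≤k : ∀ {k} (x : Cube k) → wt x ≤ k
wt≤k = count≤n (Sign._≟ Sign.+)

-- A coordinate of the product is `+` only where the two signs agree, and the other coordinates
-- cannot make up for a disagreement.
wt-⊙-top : ∀ {k} (a b : Cube k) → wt (a ⊙ b) ≡ k → b ≡ a
wt-⊙-top [] [] _ = refl
wt-⊙-top (Sign.+ ∷ a) (Sign.+ ∷ b) eq = cong (Sign.+ ∷_) (wt-⊙-top a b (ℕ.suc-injective eq))
wt-⊙-top (Sign.- ∷ a) (Sign.- ∷ b) eq = cong (Sign.- ∷_) (wt-⊙-top a b (ℕ.suc-injective eq))
wt-⊙-top (Sign.+ ∷ a) (Sign.- ∷ b) eq = contradiction eq (ℕ.<⇒≢ (s≤s (wt≤k (a ⊙ b))))
wt-⊙-top (Sign.- ∷ a) (Sign.+ ∷ b) eq = contradiction eq (ℕ.<⇒≢ (s≤s (wt≤k (a ⊙ b))))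

wt-⊙-self : ∀ {k} (a : Cube k) → wt (a ⊙ a) ≡ k
wt-⊙-self []           = refl
wt-⊙-self (Sign.+ ∷ a) = cong suc (wt-⊙-self a)
wt-⊙-self (Sign.- ∷ a) = cong suc (wt-⊙-self a)

∈top⇒≡ : ∀ {k} .{{_ : NonZero k}} {w} → w ∈[1⋯] top k → w ≡ k
∈top⇒≡ {suc n} (i , i∈ , refl) = cong suc (trans (cong toℕ (x∈⁅y⁆⇒x≡y _ i∈)) (toℕ-fromℕ n))

≡⇒∈top : ∀ k .{{_ : NonZero k}} → k ∈[1⋯] top k
≡⇒∈top (suc n) = fromℕ n , x∈⁅x⁆ (fromℕ n) , cong suc (toℕ-fromℕ n)

f-top-self : ∀ {k} .{{_ : NonZero k}} (a : Cube k) → f (top k) (a ⊙ a) ≡ 1ℝ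
f-top-self {k} a = cong (if_then 1ℝ else 0ℝ)
  (dec-true (wt (a ⊙ a) ∈[1⋯]? top k) (subst (_∈[1⋯] top k) (sym (wt-⊙-self a)) (≡⇒∈top k)))

f-top-other : ∀ {k} .{{_ : NonZero k}} (a b : Cube k) → b ≢ a → f (top k) (a ⊙ b) ≡ 0ℝ
f-top-other {k} a b b≢a = cong (if_then 1ℝ else 0ℝ)
  (dec-false (wt (a ⊙ b) ∈[1⋯]? top k) (λ m → b≢a (wt-⊙-top a b (∈top⇒≡ m))))

≡⇒≃ : ∀ {x y} → x ≡ y → x ≃ y
≡⇒≃ refl = ≃-refl

infixr 8 _^ᴿ_

_^ᴿ_ : ℝ → ℕ → ℝ
x ^ᴿ zero  = 1ℝ
x ^ᴿ suc n = x * x ^ᴿ n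

seq-^ᴿ : ∀ x i n → seq (x ^ᴿ i) n ≡ seq x n ^ i
seq-^ᴿ x zero    n = refl
seq-^ᴿ x (suc i) n = cong (seq x n *ℚ_) (seq-^ᴿ x i n)

^ᴿ-cong : ∀ {x y} i → x ≃ y → x ^ᴿ i ≃ y ^ᴿ i
^ᴿ-cong zero    eq = ≃-refl
^ᴿ-cong (suc i) eq = *-cong eq (^ᴿ-cong i eq)

φ : ℕ → ℝ → ℕ → ℝ
φ k p i = p ^ᴿ i * (1ℝ - p) ^ᴿ (k ∸ i)

seq-φ : ∀ k p i n → seq (φ k p i) n ≡ φℚ k (seq p n) i
seq-φ k p i n = cong₂ _*ℚ_ (seq-^ᴿ p i n) (seq-^ᴿ (1ℝ - p) (k ∸ i) n)

φ-cong : ∀ k {p p′} i → p ≃ p′ → φ k p i ≃ φ k p′ i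
φ-cong k {p} {p′} i eq = *-cong (^ᴿ-cong i eq) (^ᴿ-cong (k ∸ i) (+-cong ≃-refl (neg-cong eq)))

bern^-φ : ∀ {k} p (x : Cube k) → bern^ p x ≃ φ k p (wt x)
bern^-φ p [] = pointwise-≃ λ _ → refl
bern^-φ {suc k} p (Sign.+ ∷ x) = begin-equality
  p * bern^ p x                                ≈⟨ *-cong ≃-refl (bern^-φ p x) ⟩
  p * (p ^ᴿ wt x * (1ℝ - p) ^ᴿ (k ∸ wt x))     ≈⟨ pointwise-≃ (λ n → ℚ.*-assoc (seq p n) _ _) ⟨
  (p * p ^ᴿ wt x) * (1ℝ - p) ^ᴿ (k ∸ wt x)     ∎
bern^-φ {suc k} p (Sign.- ∷ x) = begin-equality
  (1ℝ - p) * bern^ p x                              ≈⟨ *-cong ≃-refl (bern^-φ p x) ⟩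
  (1ℝ - p) * (p ^ᴿ wt x * (1ℝ - p) ^ᴿ (k ∸ wt x))   ≈⟨ pointwise-≃ (λ n → *-swap (seq (1ℝ - p) n) (seq (p ^ᴿ wt x) n) (seq ((1ℝ - p) ^ᴿ (k ∸ wt x)) n)) ⟩
  p ^ᴿ wt x * (1ℝ - p) ^ᴿ suc (k ∸ wt x)            ≈⟨ ≡⇒≃ (cong (λ j → p ^ᴿ wt x * (1ℝ - p) ^ᴿ j) (ℕ.+-∸-assoc 1 (wt≤k x))) ⟨
  p ^ᴿ wt x * (1ℝ - p) ^ᴿ (suc k ∸ wt x)            ∎

expect : ∀ {k} → Δ k → (ℕ → ℝ) → ℝ
expect D h = sumCube λ x → prob D x * h (wt x)

λ-expect : ∀ {k} .{{_ : NonZero k}} (D : Δ k) p → λ[ top k ] D p ≃ expect D (φ k p)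
λ-expect {k} D p = sumCube-cong λ a → begin-equality
  sumCube (λ b → (prob D a * bern^ p b) * f (top k) (a ⊙ b))
    ≈⟨ sumCube-single _ a (λ b b≢a → ≃-trans
         (*-cong ≃-refl (≡⇒≃ (f-top-other a b b≢a))) (pointwise-≃ λ n → ℚ.*-zeroʳ (seq (prob D a * bern^ p b) n))) ⟩
  (prob D a * bern^ p a) * f (top k) (a ⊙ a)
    ≈⟨ *-cong ≃-refl (≡⇒≃ (f-top-self a)) ⟩
  (prob D a * bern^ p a) * 1ℝ
    ≈⟨ pointwise-≃ (λ n → ℚ.*-identityʳ _) ⟩
  prob D a * bern^ p a
    ≈⟨ *-cong ≃-refl (bern^-φ p a) ⟩
  prob D a * φ k p (wt a) ∎

expect-mono : ∀ {k} (D : Δ k) {g h : ℕ → ℝ} → (∀ i → i ≤ k → g i ≲ h i) →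
  expect D g ≲ expect D h
expect-mono D le = sumCube-mono λ x →
  *-monoʳ-≲ ⦅ nonNegative D x ⦆ (le (wt x) (wt≤k x))

expect-* : ∀ {k} (D : Δ k) c (h : ℕ → ℝ) → expect D (λ i → c * h i) ≃ c * expect D h
expect-* D c h = ≃-trans
  (sumCube-cong λ x → pointwise-≃ λ n → *-swap (seq (prob D x) n) (seq c n) (seq (h (wt x)) n))
  (sumCube-* c λ x → prob D x * h (wt x))

meanWeight : ∀ {k} → Δ k → ℝ
meanWeight D = expect D (λ i → fromℚ (ι i))

-- Double counting: the weight is the sum over coordinates of the indicator of `+`, and by symmetry
-- each coordinate contributes as much as the first. The induction only ever exchanges the first two
-- coordinates.
sum-weight : ∀ {n} (g : Cube (suc n) → ℝ) → (∀ x y → wt x ≡ wt y → g x ≃ g y) →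
  sumCube (λ x → g x * fromℚ (ι (wt x))) ≃ fromℚ (ι (suc n)) * sumCube (λ x → g (Sign.+ ∷ x))
sum-weight {zero} g _ = pointwise-≃ λ n →
  identity (seq (g (Sign.+ ∷ [])) n) (seq (g (Sign.- ∷ [])) n)
  where
  open +-*-Solver
  identity : ∀ a b → a *ℚ (1ℚ +ℚ 0ℚ) +ℚ b *ℚ 0ℚ ≡ (1ℚ +ℚ 0ℚ) *ℚ a
  identity = solve 2 (λ a b → a :* (con 1ℚ :+ con 0ℚ) :+ b :* con 0ℚ := (con 1ℚ :+ con 0ℚ) :* a) refl
sum-weight {suc n} g sym-g = begin-equality
  sumCube (λ x → g x * fromℚ (ι (wt x)))
    ≈⟨ +-cong
         (≃-trans
           (sumCube-cong {g = λ x → g₊ x * fromℚ (ι (suc (wt x)))} {h = λ x → g₊ x + g₊ x * fromℚ (ι (wt x))}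
             λ x → pointwise-≃ λ m → split (seq (g₊ x) m) (ι (wt x)))
           (sumCube-+ g₊ λ x → g₊ x * fromℚ (ι (wt x))))
         ≃-refl ⟩
  (sumCube g₊ + sumCube (λ x → g₊ x * fromℚ (ι (wt x)))) + sumCube (λ x → g₋ x * fromℚ (ι (wt x)))
    ≈⟨ +-cong (+-cong ≃-refl (sum-weight g₊ λ x y eq → sym-g _ _ (cong suc eq)))
              (≃-trans (sum-weight g₋ λ x y eq → sym-g _ _ eq)
                       (*-cong ≃-refl (sumCube-cong λ x → sym-g (Sign.- ∷ Sign.+ ∷ x) (Sign.+ ∷ Sign.- ∷ x) refl))) ⟩
  (sumCube g₊ + N * S) + N * T
    ≈⟨ pointwise-≃ (λ m → collect (seq S m) (seq T m) (ι (suc n))) ⟩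
  fromℚ (ι (suc (suc n))) * sumCube g₊ ∎
  where
  open +-*-Solver
  g₊ g₋ : Cube (suc n) → ℝ
  g₊ x = g (Sign.+ ∷ x)
  g₋ x = g (Sign.- ∷ x)

  N S T : ℝ
  N = fromℚ (ι (suc n))
  S = sumCube λ x → g₊ (Sign.+ ∷ x)
  T = sumCube λ x → g₊ (Sign.- ∷ x)

  split : ∀ a w → a *ℚ (1ℚ +ℚ w) ≡ a +ℚ a *ℚ w
  split = solve 2 (λ a w → a :* (con 1ℚ :+ w) := a :+ a :* w) refl

  collect : ∀ s t n → ((s +ℚ t) +ℚ n *ℚ s) +ℚ n *ℚ t ≡ (1ℚ +ℚ n) *ℚ (s +ℚ t)
  collect = solve 3 (λ s t n → ((s :+ t) :+ n :* s) :+ n :* t := (con 1ℚ :+ n) :* (s :+ t)) refl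

-- The first coordinate is 1 with probability (1 + μ) / 2: the total mass is `P₊` + `P₋`, and μ is
-- their difference.
mean-weight : ∀ {k} .{{_ : NonZero k}} (D : Δ k) →
  meanWeight D ≃ fromℚ (ι k *ℚ ½) * (1ℝ + μ D)
mean-weight {suc n} D = begin-equality
  meanWeight D
    ≈⟨ sum-weight (prob D) (λ x y eq → ⦅ symmetric D x y eq ⦆) ⟩
  fromℚ (ι (suc n)) * P₊
    ≈⟨ pointwise-≃ (λ m → double (ι (suc n)) (seq P₊ m) (seq P₋ m)) ⟩
  fromℚ (ι (suc n) *ℚ ½) * ((P₊ + P₋) + (P₊ - P₋))
    ≈⟨ *-cong ≃-refl (+-cong ⦅ total D ⦆ (≃-sym mu)) ⟩
  fromℚ (ι (suc n) *ℚ ½) * (1ℝ + μ D) ∎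
  where
  open +-*-Solver
  P₊ P₋ : ℝ
  P₊ = sumCube λ x → prob D (Sign.+ ∷ x)
  P₋ = sumCube λ x → prob D (Sign.- ∷ x)

  double : ∀ n p q → n *ℚ p ≡ (n *ℚ ½) *ℚ ((p +ℚ q) +ℚ (p -ℚ q))
  double = solve 3 (λ n p q → n :* p := (n :* con ½) :* ((p :+ q) :+ (p :- q))) refl

  mu : μ D ≃ P₊ - P₋
  mu = +-cong
    (sumCube-cong {g = λ x → prob D (Sign.+ ∷ x) * 1ℝ} {h = λ x → prob D (Sign.+ ∷ x)} λ x → pointwise-≃ λ m → ℚ.*-identityʳ _)
    (begin-equality
      sumCube (λ x → prob D (Sign.- ∷ x) * (- 1ℝ))
        ≈⟨ sumCube-cong (λ x → pointwise-≃ λ m → ℚ.*-comm (seq (prob D (Sign.- ∷ x)) m) (-ℚ 1ℚ)) ⟩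
      sumCube (λ x → (- 1ℝ) * prob D (Sign.- ∷ x))
        ≈⟨ sumCube-* (- 1ℝ) (λ x → prob D (Sign.- ∷ x)) ⟩
      (- 1ℝ) * P₋
        ≈⟨ pointwise-≃ (λ m → solve 1 (λ a → con (-ℚ 1ℚ) :* a := :- a) refl (seq P₋ m)) ⟩
      - P₋ ∎)

φ-fromℚ : ∀ k q i → φ k (fromℚ q) i ≃ fromℚ (φℚ k q i)
φ-fromℚ k q i = pointwise-≃ (seq-φ k (fromℚ q) i)

μ-mean-weight : ∀ {k} .{{_ : NonZero k}} (D D′ : Δ k) → meanWeight D ≃ meanWeight D′ → μ D ≃ μ D′
μ-mean-weight {k} D D′ eq = begin-equality
  μ D                                     ≈⟨ recover D ⟩
  fromℚ (T *ℚ (1ℚ +ℚ 1ℚ)) * meanWeight D - 1ℝ  ≈⟨ +-cong (*-cong ≃-refl eq) ≃-refl ⟩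
  fromℚ (T *ℚ (1ℚ +ℚ 1ℚ)) * meanWeight D′ - 1ℝ ≈⟨ recover D′ ⟨
  μ D′                                    ∎
  where
  open +-*-Solver
  inverse : ∃[ r ] (0ℚ <ℚ r × r *ℚ ι k ≡ 1ℚ)
  inverse = positive-inverse (0<ι k)
  T : ℚ
  T = proj₁ inverse

  regroup : ∀ t k m → (t *ℚ (1ℚ +ℚ 1ℚ)) *ℚ ((k *ℚ ½) *ℚ (1ℚ +ℚ m)) -ℚ 1ℚ ≡ (t *ℚ k) *ℚ (1ℚ +ℚ m) -ℚ 1ℚ
  regroup = solve 3 (λ t k m → (t :* (con 1ℚ :+ con 1ℚ)) :* ((k :* con ½) :* (con 1ℚ :+ m)) :- con 1ℚ
    := (t :* k) :* (con 1ℚ :+ m) :- con 1ℚ) refl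

  cancel : ∀ m → 1ℚ *ℚ (1ℚ +ℚ m) -ℚ 1ℚ ≡ m
  cancel = solve 1 (λ m → con 1ℚ :* (con 1ℚ :+ m) :- con 1ℚ := m) refl

  recover : ∀ D → μ D ≃ fromℚ (T *ℚ (1ℚ +ℚ 1ℚ)) * meanWeight D - 1ℝ
  recover D = ≃-sym (≃-trans (+-cong (*-cong ≃-refl (mean-weight D)) ≃-refl)
    (pointwise-≃ λ n → trans (regroup T (ι k) (seq (μ D) n))
      (trans (cong (λ u → u *ℚ (1ℚ +ℚ seq (μ D) n) -ℚ 1ℚ) (proj₂ (proj₂ inverse)))
             (cancel (seq (μ D) n)))))

-- Mixtures of uniform distributions on two weights

atWeight : ℚ → ℕ → ℕ → ℚ
atWeight c i w = if w ≡ᵇ i then c else 0ℚ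

atWeight-nonNeg : ∀ {c} i w → 0ℚ ≤ℚ c → 0ℚ ≤ℚ atWeight c i w
atWeight-nonNeg i w 0≤c with w ≡ᵇ i
... | true  = 0≤c
... | false = ℚ.≤-refl

atWeight-* : ∀ c i w (h : ℕ → ℝ) → fromℚ (atWeight c i w) * h w ≃ h i * fromℚ (atWeight c i w)
atWeight-* c i w h with w ≡ᵇ i in eq
... | false = pointwise-≃ λ n → trans (ℚ.*-zeroˡ (seq (h w) n)) (sym (ℚ.*-zeroʳ (seq (h i) n)))
... | true  = pointwise-≃ λ n → trans (ℚ.*-comm c (seq (h w) n))
  (cong (λ v → seq (h v) n *ℚ c) (ℕ.≡ᵇ⇒≡ w i (subst Bool.T (sym eq) _)))

-- Splitting off the first coordinate is Pascal's rule for the number of vectors of weight i.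
sum-atWeight : ∀ {k} c i → sumCube {k} (λ x → fromℚ (atWeight c i (wt x))) ≃ fromℚ (c *ℚ ι (k C i))
sum-atWeight {zero} c zero    = pointwise-≃ λ _ → sym (ℚ.*-identityʳ c)
sum-atWeight {zero} c (suc i) = pointwise-≃ λ _ → sym (ℚ.*-zeroʳ c)
sum-atWeight {suc k} c zero = begin-equality
  sumCube {suc k} (λ x → fromℚ (atWeight c 0 (wt x)))
    ≈⟨ +-cong (sumCube-zero {k} (λ _ → ≃-refl)) (sum-atWeight {k} c 0) ⟩
  0ℝ + fromℚ (c *ℚ ι 1)
    ≈⟨ pointwise-≃ (λ _ → ℚ.+-identityˡ (c *ℚ ι 1)) ⟩
  fromℚ (c *ℚ ι 1) ∎
sum-atWeight {suc k} c (suc i) = begin-equality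
  sumCube {suc k} (λ x → fromℚ (atWeight c (suc i) (wt x)))
    ≈⟨ +-cong (sum-atWeight {k} c i) (sum-atWeight {k} c (suc i)) ⟩
  fromℚ (c *ℚ ι (k C i)) + fromℚ (c *ℚ ι (k C suc i))
    ≈⟨ pointwise-≃ (λ _ → trans (sym (ℚ.*-distribˡ-+ c (ι (k C i)) (ι (k C suc i))))
         (cong (c *ℚ_) (trans (sym (ι-+ (k C i) (k C suc i)))
                              (cong ι (nCk+nC[k+1]≡[n+1]C[k+1] k i))))) ⟩
  fromℚ (c *ℚ ι (suc k C suc i)) ∎

C-pos : ∀ {k i} → i ≤ k → 0 ℕ.< k C i
C-pos {i = zero} z≤n = s≤s z≤n
C-pos {suc k} {suc i} (s≤s i≤k) = subst (0 ℕ.<_) (nCk+nC[k+1]≡[n+1]C[k+1] k i)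
  (ℕ.<-≤-trans (C-pos i≤k) (ℕ.m≤m+n (k C i) (k C suc i)))

uniform-mass : ∀ {k i} → i ≤ k → ∃[ c ] (0ℚ <ℚ c × c *ℚ ι (k C i) ≡ 1ℚ)
uniform-mass {k} {i} i≤k = positive-inverse (0<ι (k C i) {{ℕ.>-nonZero (C-pos i≤k)}})

expect-uniform : ∀ {k i} (i≤k : i ≤ k) (h : ℕ → ℝ) →
  sumCube {k} (λ x → fromℚ (atWeight (proj₁ (uniform-mass i≤k)) i (wt x)) * h (wt x)) ≃ h i
expect-uniform {k} {i} i≤k h = begin-equality
  sumCube {k} (λ x → fromℚ (atWeight c i (wt x)) * h (wt x))
    ≈⟨ sumCube-cong {k} (λ x → atWeight-* c i (wt x) h) ⟩
  sumCube {k} (λ x → h i * fromℚ (atWeight c i (wt x)))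
    ≈⟨ sumCube-* {k} (h i) (λ x → fromℚ (atWeight c i (wt x))) ⟩
  h i * sumCube {k} (λ x → fromℚ (atWeight c i (wt x)))
    ≈⟨ *-cong ≃-refl (sum-atWeight {k} c i) ⟩
  h i * fromℚ (c *ℚ ι (k C i))
    ≈⟨ pointwise-≃ (λ n → trans (cong (seq (h i) n *ℚ_) (proj₂ (proj₂ (uniform-mass i≤k))))
                                 (ℚ.*-identityʳ (seq (h i) n))) ⟩
  h i ∎
  where
  c : ℚ
  c = proj₁ (uniform-mass i≤k)

mix : ℚ → ℚ → ℚ → ℚ
mix c u v = c *ℚ u +ℚ (1ℚ -ℚ c) *ℚ v

mix-nonNeg : ∀ {c u v} → 0ℚ ≤ℚ c → c ≤ℚ 1ℚ → 0ℚ ≤ℚ u → 0ℚ ≤ℚ v → 0ℚ ≤ℚ mix c u v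
mix-nonNeg 0≤c c≤1 0≤u 0≤v = ℚ.+-mono-≤ (*-nonNegℚ 0≤c 0≤u) (*-nonNegℚ (0≤q-p c≤1) 0≤v)

mix-mono : ∀ {c u u′ v v′} → 0ℚ ≤ℚ c → c ≤ℚ 1ℚ → u ≤ℚ u′ → v ≤ℚ v′ → mix c u v ≤ℚ mix c u′ v′
mix-mono {c} 0≤c c≤1 u≤ v≤ =
  ℚ.+-mono-≤ (*-monoʳℚ c 0≤c u≤) (*-monoʳℚ (1ℚ -ℚ c) (0≤q-p c≤1) v≤)

mix-self : ∀ c u → mix c u u ≡ u
mix-self = solve 2 (λ c u → c :* u :+ (con 1ℚ :- c) :* u := u) refl
  where open +-*-Solver

mixᴿ : ℚ → ℝ → ℝ → ℝ
mixᴿ c u v = fromℚ c * u + fromℚ (1ℚ -ℚ c) * v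

abstract
  -- All that matters later are the expectations, so `abstract` keeps the masses from unfolding.
  mixture : ∀ {k} c i j → 0ℚ ≤ℚ c → c ≤ℚ 1ℚ → i ≤ k → j ≤ k →
    Σ (Δ k) λ D → ∀ h → expect D h ≃ mixᴿ c (h i) (h j)
  mixture {k} c i j 0≤c c≤1 i≤k j≤k = D , expect-mass
    where
    open +-*-Solver
    a b mass : ℕ → ℚ
    a w = atWeight (proj₁ (uniform-mass i≤k)) i w
    b w = atWeight (proj₁ (uniform-mass j≤k)) j w
    mass w = mix c (a w) (b w)

    distrib : ∀ c u d v h → (c *ℚ u +ℚ d *ℚ v) *ℚ h ≡ c *ℚ (u *ℚ h) +ℚ d *ℚ (v *ℚ h)
    distrib = solve 5 (λ c u d v h → (c :* u :+ d :* v) :* h := c :* (u :* h) :+ d :* (v :* h)) refl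

    expect-mass : ∀ (h : ℕ → ℝ) → sumCube {k} (λ x → fromℚ (mass (wt x)) * h (wt x)) ≃ mixᴿ c (h i) (h j)
    expect-mass h = begin-equality
      sumCube {k} (λ x → fromℚ (mass (wt x)) * h (wt x))
        ≈⟨ sumCube-cong {k} (λ x → pointwise-≃ λ n → distrib c (a (wt x)) (1ℚ -ℚ c) (b (wt x)) (seq (h (wt x)) n)) ⟩
      sumCube {k} (λ x → fromℚ c * (fromℚ (a (wt x)) * h (wt x)) + fromℚ (1ℚ -ℚ c) * (fromℚ (b (wt x)) * h (wt x)))
        ≈⟨ sumCube-+ {k} (λ x → fromℚ c * (fromℚ (a (wt x)) * h (wt x))) (λ x → fromℚ (1ℚ -ℚ c) * (fromℚ (b (wt x)) * h (wt x))) ⟩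
      sumCube {k} (λ x → fromℚ c * (fromℚ (a (wt x)) * h (wt x))) + sumCube {k} (λ x → fromℚ (1ℚ -ℚ c) * (fromℚ (b (wt x)) * h (wt x)))
        ≈⟨ +-cong (sumCube-* {k} (fromℚ c) (λ x → fromℚ (a (wt x)) * h (wt x)))
                  (sumCube-* {k} (fromℚ (1ℚ -ℚ c)) (λ x → fromℚ (b (wt x)) * h (wt x))) ⟩
      mixᴿ c (sumCube {k} (λ x → fromℚ (a (wt x)) * h (wt x))) (sumCube {k} (λ x → fromℚ (b (wt x)) * h (wt x)))
        ≈⟨ +-cong (*-cong ≃-refl (expect-uniform i≤k h)) (*-cong ≃-refl (expect-uniform j≤k h)) ⟩
      mixᴿ c (h i) (h j) ∎

    D : Δ k
    D = record
      { prob        = λ x → fromℚ (mass (wt x))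
      ; nonNegative = λ x → un≲ (pointwise-≲ {0ℝ} {fromℚ (mass (wt x))} λ _ → mix-nonNeg 0≤c c≤1
          (atWeight-nonNeg i (wt x) (ℚ.<⇒≤ (proj₁ (proj₂ (uniform-mass i≤k)))))
          (atWeight-nonNeg j (wt x) (ℚ.<⇒≤ (proj₁ (proj₂ (uniform-mass j≤k))))))
      ; total       = un≃ (begin-equality
          sumCube {k} (λ x → fromℚ (mass (wt x)))
            ≈⟨ sumCube-cong {k} (λ x → pointwise-≃ λ _ → ℚ.*-identityʳ (mass (wt x))) ⟨
          sumCube {k} (λ x → fromℚ (mass (wt x)) * 1ℝ)
            ≈⟨ expect-mass (λ _ → 1ℝ) ⟩
          mixᴿ c 1ℝ 1ℝ
            ≈⟨ pointwise-≃ (λ _ → mix-self c 1ℚ) ⟩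
          1ℝ ∎)
      ; symmetric   = λ x y eq → un≃ (≡⇒≃ (cong (λ w → fromℚ (mass w)) eq))
      }

-- From the rational bounds to the approximation ratio

γ-nonNeg : ∀ {k} .{{_ : NonZero k}} (D : Δ k) → 0ℝ ≲ γ[ top k ] D
γ-nonNeg {k} D = begin
  0ℝ                   ≈⟨ sumCube-zero (λ x → pointwise-≃ λ n → ℚ.*-zeroʳ (seq (prob D x) n)) ⟨
  expect D (λ _ → 0ℝ)  ≲⟨ expect-mono D (λ i _ → begin
    0ℝ                 ≲⟨ pointwise-≲ (λ _ → φℚ-nonNeg k i (ℚ.nonNegative⁻¹ 1ℚ) ℚ.≤-refl) ⟩
    fromℚ (φℚ k 1ℚ i)  ≈⟨ φ-fromℚ k 1ℚ i ⟨
    φ k 1ℝ i           ∎) ⟩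
  expect D (φ k 1ℝ)    ≈⟨ λ-expect D 1ℝ ⟨
  γ[ top k ] D         ∎

γ-mean-weight : ∀ {k} .{{_ : NonZero k}} (D : Δ k) → fromℚ (ι k) * γ[ top k ] D ≲ meanWeight D
γ-mean-weight {k} D = begin
  fromℚ (ι k) * γ[ top k ] D                ≈⟨ *-cong ≃-refl (λ-expect D 1ℝ) ⟩
  fromℚ (ι k) * expect D (φ k 1ℝ)           ≈⟨ expect-* D (fromℚ (ι k)) (φ k 1ℝ) ⟨
  expect D (λ i → fromℚ (ι k) * φ k 1ℝ i)   ≲⟨ expect-mono D {h = λ i → fromℚ (ι i)} (λ i i≤k →
                                                 ≲-trans (≃⇒≲ (*-cong ≃-refl (φ-fromℚ k 1ℚ i)))
                                                         (pointwise-≲ λ _ → φℚ-one-≤ i≤k)) ⟩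
  meanWeight D                              ∎

fromℚ-≉0 : ∀ {d} → 0ℚ <ℚ d → ¬ (fromℚ d ≈ 0ℝ)
fromℚ-≉0 {d} 0<d d≈0 = let n , h = d≈0 d 0<d in ℚ.<-irrefl
  (trans (cong ∣_∣ (ℚ.+-identityʳ d)) (ℚ.0≤p⇒∣p∣≡p (ℚ.<⇒≤ 0<d))) (h n ℕ.≤-refl)

-- Duality: p is an optimal strategy against every D_N, and the mixture of the
-- uniform distributions on the weights i and j is an optimal D_N.
saddle-point : ∀ k .{{_ : NonZero k}} (a p c : ℚ) (i j : ℕ) → 0ℚ ≤ℚ a →
  0ℚ ≤ℚ p → p ≤ℚ 1ℚ → 0ℚ ≤ℚ c → c ≤ℚ 1ℚ → i ≤ k → j ≤ k →
  0ℚ <ℚ mix c (ι i) (ι j) →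
  (∀ w → w ≤ k → a *ℚ ι w ≤ℚ ι k *ℚ φℚ k p w) →
  (∀ q → 0ℚ ≤ℚ q → q ≤ℚ 1ℚ → ι k *ℚ mix c (φℚ k q i) (φℚ k q j) ≤ℚ a *ℚ mix c (ι i) (ι j)) →
  IsApproxRatio (top k) (fromℚ a)
saddle-point k a p c i j 0≤a 0≤p p≤1 0≤c c≤1 i≤k j≤k 0<M lower upper =
  -- The value `a` is itself one of the ratios, so every lower bound lies below it.
  bound , λ l is-lower → is-lower [ fromℚ a ] attained
  where
  open +-*-Solver
  inverse : ∃[ r ] (0ℚ <ℚ r × r *ℚ ι k ≡ 1ℚ)
  inverse = positive-inverse (0<ι k)

  -- `M` is the mean weight of the optimal D_N. The quotient `d` = M / k will be γ of the optimal
  -- D_Y, and `B` will be β of the optimal D_N.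
  T M d B : ℚ
  T = proj₁ inverse
  M = mix c (ι i) (ι j)
  d = T *ℚ M
  B = a *ℚ d

  0≤T : 0ℚ ≤ℚ T
  0≤T = ℚ.<⇒≤ (proj₁ (proj₂ inverse))

  0<d : 0ℚ <ℚ d
  0<d = *-posℚ (proj₁ (proj₂ inverse)) 0<M

  T*k*x≡x : ∀ x → T *ℚ (ι k *ℚ x) ≡ x
  T*k*x≡x x = trans (sym (ℚ.*-assoc T (ι k) x))
    (trans (cong (_*ℚ x) (proj₂ (proj₂ inverse))) (ℚ.*-identityˡ x))

  d≤1 : d ≤ℚ 1ℚ
  d≤1 = subst (d ≤ℚ_) (trans (cong (T *ℚ_) (mix-self c (ι k))) (proj₂ (proj₂ inverse)))
    (*-monoʳℚ T 0≤T (mix-mono 0≤c c≤1 (ι-mono i≤k) (ι-mono j≤k)))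

  T-≲ : ∀ {x y} → fromℚ (ι k) * x ≲ fromℚ (ι k) * y → x ≲ y
  T-≲ {x} {y} h = begin
    x                             ≈⟨ pointwise-≃ (λ n → T*k*x≡x (seq x n)) ⟨
    fromℚ T * (fromℚ (ι k) * x)   ≲⟨ *-monoʳ-≲ (pointwise-≲ λ _ → 0≤T) h ⟩
    fromℚ T * (fromℚ (ι k) * y)   ≈⟨ pointwise-≃ (λ n → T*k*x≡x (seq y n)) ⟩
    y                             ∎

  a-mean≲λ : ∀ D → fromℚ a * meanWeight D ≲ fromℚ (ι k) * λ[ top k ] D (fromℚ p)
  a-mean≲λ D = begin
    fromℚ a * meanWeight D                          ≈⟨ expect-* D (fromℚ a) (λ w → fromℚ (ι w)) ⟨
    expect D (λ w → fromℚ a * fromℚ (ι w))          ≲⟨ expect-mono D {λ w → fromℚ a * fromℚ (ι w)} (λ w w≤k → ≲-trans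
                                                         (pointwise-≲ λ _ → lower w w≤k)
                                                         (≃⇒≲ (*-cong {fromℚ (ι k)} ≃-refl (≃-sym (φ-fromℚ k p w))))) ⟩
    expect D (λ w → fromℚ (ι k) * φ k (fromℚ p) w)  ≈⟨ expect-* D (fromℚ (ι k)) (φ k (fromℚ p)) ⟩
    fromℚ (ι k) * expect D (φ k (fromℚ p))          ≈⟨ *-cong ≃-refl (λ-expect D (fromℚ p)) ⟨
    fromℚ (ι k) * λ[ top k ] D (fromℚ p)            ∎

  bound : ∀ r → Ratio (top k) r → _≤⁺_ _≤ᴿ_ [ fromℚ a ] r
  bound _ (Dᴺ , Dʸ , β , _ , _ , infinite _) = _ ≤⊤⁺
  bound _ (Dᴺ , Dʸ , β , μ≈ , (β-upper , _) , finite {r} γ≉0 rγ≈β) =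
    [ un≲ (*-cancelʳ-≲ (γ-nonNeg Dʸ) γ≉0 (T-≲ (begin
      fromℚ (ι k) * (fromℚ a * γ[ top k ] Dʸ)  ≈⟨ pointwise-≃ (λ n → *-swap (ι k) a (seq (γ[ top k ] Dʸ) n)) ⟩
      fromℚ a * (fromℚ (ι k) * γ[ top k ] Dʸ)  ≲⟨ *-monoʳ-≲ 0≤aᴿ (γ-mean-weight Dʸ) ⟩
      fromℚ a * meanWeight Dʸ                  ≈⟨ *-cong ≃-refl (mean-weight Dʸ) ⟩
      fromℚ a * (fromℚ (ι k *ℚ ½) * (1ℝ + μ Dʸ)) ≈⟨ *-cong ≃-refl (*-cong ≃-refl (+-cong ≃-refl ⦅ μ≈ ⦆)) ⟨
      fromℚ a * (fromℚ (ι k *ℚ ½) * (1ℝ + μ Dᴺ)) ≈⟨ *-cong ≃-refl (mean-weight Dᴺ) ⟨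
      fromℚ a * meanWeight Dᴺ                  ≲⟨ a-mean≲λ Dᴺ ⟩
      fromℚ (ι k) * λ[ top k ] Dᴺ (fromℚ p)    ≲⟨ *-monoʳ-≲ (pointwise-≲ λ _ → 0≤ι k) ⦅ β-upper (fromℚ p) p∈[0,1] ⦆ ⟩
      fromℚ (ι k) * β                          ≈⟨ *-cong ≃-refl ⦅ rγ≈β ⦆ ⟨
      fromℚ (ι k) * (r * γ[ top k ] Dʸ)        ∎))) ]
    where
    0≤aᴿ : 0ℝ ≲ fromℚ a
    0≤aᴿ = pointwise-≲ λ _ → 0≤a
    p∈[0,1] : UnitInterval (fromℚ p)
    p∈[0,1] = un≲ (pointwise-≲ {0ℝ} {fromℚ p} λ _ → 0≤p) , un≲ (pointwise-≲ {fromℚ p} {1ℝ} λ _ → p≤1)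

  Nmix : Σ (Δ k) λ D → ∀ h → expect D h ≃ mixᴿ c (h i) (h j)
  Nmix = mixture c i j 0≤c c≤1 i≤k j≤k

  Ymix : Σ (Δ k) λ D → ∀ h → expect D h ≃ mixᴿ d (h k) (h 0)
  Ymix = mixture d k 0 (ℚ.<⇒≤ 0<d) d≤1 ℕ.≤-refl z≤n

  N Y : Δ k
  N = proj₁ Nmix
  Y = proj₁ Ymix

  mix-φ-bound : ∀ q → 0ℚ ≤ℚ q → q ≤ℚ 1ℚ → mix c (φℚ k q i) (φℚ k q j) ≤ℚ B
  mix-φ-bound q 0≤q q≤1 = subst₂ _≤ℚ_ (T*k*x≡x _)
    (solve 3 (λ t a m → t :* (a :* m) := a :* (t :* m)) refl T a M)
    (*-monoʳℚ T 0≤T (upper q 0≤q q≤1))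

  λ-N : ∀ p → λ[ top k ] N p ≃ mixᴿ c (φ k p i) (φ k p j)
  λ-N p = ≃-trans (λ-expect N p) (proj₂ Nmix (φ k p))

  mean-N : meanWeight N ≃ fromℚ M
  mean-N = ≃-trans (proj₂ Nmix (λ w → fromℚ (ι w))) (pointwise-≃ λ _ → refl)

  β-N : IsBeta (top k) N (fromℚ B)
  β-N = above , λ u u-above → un≲ (≲-trans {z = u} B≲λ ⦅ u-above (fromℚ p)
          (un≲ (pointwise-≲ {0ℝ} {fromℚ p} λ _ → 0≤p) , un≲ (pointwise-≲ {fromℚ p} {1ℝ} λ _ → p≤1)) ⦆)
    where
    above : ∀ q → UnitInterval q → λ[ top k ] N q ≤ᴿ fromℚ B
    above q (0≤q , q≤1) =
      let q′ , q≃q′ , 0≤q′ , q′≤1 = unit-representative ⦅ 0≤q ⦆ ⦅ q≤1 ⦆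
      in un≲ (begin
        λ[ top k ] N q                    ≈⟨ λ-N q ⟩
        mixᴿ c (φ k q i) (φ k q j)        ≈⟨ +-cong (*-cong ≃-refl (φ-cong k i q≃q′)) (*-cong ≃-refl (φ-cong k j q≃q′)) ⟩
        mixᴿ c (φ k q′ i) (φ k q′ j)      ≲⟨ pointwise-≲ (λ n → subst₂ (λ u v → mix c u v ≤ℚ B)
                                               (sym (seq-φ k q′ i n)) (sym (seq-φ k q′ j n))
                                               (mix-φ-bound (seq q′ n) (0≤q′ n) (q′≤1 n))) ⟩
        fromℚ B                           ∎)

    -- The bound that p guarantees against every distribution, applied to `N`, shows that the
    -- supremum is reached at p.
    B≲λ : fromℚ B ≲ λ[ top k ] N (fromℚ p)
    B≲λ = T-≲ (begin
      fromℚ (ι k) * fromℚ B                  ≈⟨ pointwise-≃ (λ _ → solve 4 (λ k a t m → k :* (a :* (t :* m)) := a :* (t :* (k :* m))) refl (ι k) a T M) ⟩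
      fromℚ (a *ℚ (T *ℚ (ι k *ℚ M)))         ≈⟨ pointwise-≃ (λ _ → cong (a *ℚ_) (T*k*x≡x M)) ⟩
      fromℚ a * fromℚ M                      ≈⟨ *-cong ≃-refl (mean-N) ⟨
      fromℚ a * meanWeight N                 ≲⟨ a-mean≲λ N ⟩
      fromℚ (ι k) * λ[ top k ] N (fromℚ p)   ∎)

  same-μ : μ N ≃ μ Y
  same-μ = μ-mean-weight N Y (begin-equality
    meanWeight N                              ≈⟨ mean-N ⟩
    fromℚ M                                   ≈⟨ pointwise-≃ (λ _ → T*k*x≡x M) ⟨
    fromℚ (T *ℚ (ι k *ℚ M))                   ≈⟨ pointwise-≃ (λ _ → solve 3 (λ t k m → (t :* m) :* k :+ (con 1ℚ :- t :* m) :* con 0ℚ := t :* (k :* m)) refl T (ι k) M) ⟨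
    mixᴿ d (fromℚ (ι k)) (fromℚ 0ℚ)           ≈⟨ proj₂ Ymix (λ w → fromℚ (ι w)) ⟨
    meanWeight Y                              ∎)

  γ-Y : γ[ top k ] Y ≃ fromℚ d
  γ-Y = begin-equality
    γ[ top k ] Y                                    ≈⟨ λ-expect Y 1ℝ ⟩
    expect Y (φ k 1ℝ)                               ≈⟨ proj₂ Ymix (φ k 1ℝ) ⟩
    mixᴿ d (φ k 1ℝ k) (φ k 1ℝ 0)                    ≈⟨ +-cong (*-cong ≃-refl (φ-fromℚ k 1ℚ k)) (*-cong ≃-refl (φ-fromℚ k 1ℚ 0)) ⟩
    mixᴿ d (fromℚ (φℚ k 1ℚ k)) (fromℚ (φℚ k 1ℚ 0))  ≈⟨ pointwise-≃ (λ _ → cong₂ (mix d) (φℚ-one-top k) (φℚ-one-other k 0 (sym (ℕ.suc-pred k)))) ⟩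
    fromℚ (mix d 1ℚ 0ℚ)                             ≈⟨ pointwise-≃ (λ _ → solve 1 (λ d → d :* con 1ℚ :+ (con 1ℚ :- d) :* con 0ℚ := d) refl d) ⟩
    fromℚ d                                         ∎

  γ-Y≉0 : ¬ (γ[ top k ] Y ≈ 0ℝ)
  γ-Y≉0 γ≈0 = fromℚ-≉0 0<d (un≃ {fromℚ d} {0ℝ} (≃-trans (≃-sym γ-Y) ⦅ γ≈0 ⦆))

  attained : Ratio (top k) [ fromℚ a ]
  attained = N , Y , fromℚ B , un≃ same-μ , β-N , finite γ-Y≉0
    (un≃ {fromℚ a * γ[ top k ] Y} {fromℚ B} (≃-trans (*-cong ≃-refl γ-Y) (pointwise-≃ λ _ → refl)))

-- The two parities of k

mix-one : ∀ u v → mix 1ℚ u v ≡ u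
mix-one = solve 2 (λ u v → con 1ℚ :* u :+ (con 1ℚ :- con 1ℚ) :* v := u) refl
  where open +-*-Solver

odd-ratio : ∀ m .{{_ : NonZero m}} → IsApproxRatio (top (suc (2 ℕ.* m))) (fromℚ (Optimum.A m ^ m))
-- The coefficient c = 1 puts all mass on the weight m + 1; the second weight 0 is a placeholder of
-- mass 0.
odd-ratio m = saddle-point (suc (2 ℕ.* m)) (A ^ m) p 1ℚ (suc m) 0
  (^-nonNeg m 0≤A) 0≤p p≤1 (ℚ.nonNegative⁻¹ 1ℚ) ℚ.≤-refl
  (s≤s (ℕ.m≤m+n m (m ℕ.+ 0))) z≤n
  (subst (0ℚ <ℚ_) (sym (mix-one N 0ℚ)) 0<N)
  lower-odd
  (λ q 0≤q q≤1 → subst₂ (λ u v → ι (suc (2 ℕ.* m)) *ℚ u ≤ℚ A ^ m *ℚ v)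
    (sym (mix-one (φℚ (suc (2 ℕ.* m)) q (suc m)) (φℚ (suc (2 ℕ.* m)) q 0))) (sym (mix-one N 0ℚ))
    (upper-odd (0<ι m) q 0≤q q≤1))
  where open Optimum m

-- The uniform distributions on the weights m and m + 1 are mixed in the
-- proportion N² : M², which makes p a critical point of λ(D_N, ·).
even-ratio : ∀ n → IsApproxRatio (top (2 ℕ.* suc n)) (fromℚ ((1ℚ +ℚ 1ℚ) *ℚ Optimum.A (suc n) ^ suc n))
even-ratio n = saddle-point k a p c m (suc m)
  0≤a 0≤p p≤1 0≤c c≤1 (ℕ.m≤m+n m (m ℕ.+ 0)) (ℕ.m<m+n m (s≤s z≤n))
  0<mean lower-even upper
  where
  open +-*-Solver
  open Optimum (suc n)
  m k : ℕ
  m = suc n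
  k = 2 ℕ.* suc n

  a : ℚ
  a = (1ℚ +ℚ 1ℚ) *ℚ A ^ m

  0≤2 : 0ℚ ≤ℚ 1ℚ +ℚ 1ℚ
  0≤2 = ℚ.nonNegative⁻¹ (1ℚ +ℚ 1ℚ)

  0≤a : 0ℚ ≤ℚ a
  0≤a = *-nonNegℚ 0≤2 (^-nonNeg m 0≤A)

  total-inverse : ∃[ s ] (0ℚ <ℚ s × s *ℚ (N *ℚ N +ℚ M *ℚ M) ≡ 1ℚ)
  total-inverse = positive-inverse (ℚ.+-mono-<-≤ (*-posℚ 0<N 0<N) (square-nonNeg M))

  s c : ℚ
  s = proj₁ total-inverse
  c = s *ℚ (N *ℚ N)

  0<s : 0ℚ <ℚ s
  0<s = proj₁ (proj₂ total-inverse)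

  1-c : 1ℚ -ℚ c ≡ s *ℚ (M *ℚ M)
  1-c = trans (cong (_-ℚ c) (sym (proj₂ (proj₂ total-inverse))))
    (solve 3 (λ s N M → s :* (N :+ M) :- s :* N := s :* M) refl s (N *ℚ N) (M *ℚ M))

  mix≡ : ∀ u v → mix c u v ≡ s *ℚ (N *ℚ N *ℚ u +ℚ M *ℚ M *ℚ v)
  mix≡ u v = trans (cong (λ d → c *ℚ u +ℚ d *ℚ v) 1-c)
    (solve 5 (λ s N M u v → s :* N :* u :+ s :* M :* v := s :* (N :* u :+ M :* v)) refl
      s (N *ℚ N) (M *ℚ M) u v)

  0≤c : 0ℚ ≤ℚ c
  0≤c = *-nonNegℚ (ℚ.<⇒≤ 0<s) (square-nonNeg N)

  c≤1 : c ≤ℚ 1ℚ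
  c≤1 = 0≤q-p⇒p≤q (subst (0ℚ ≤ℚ_) (sym 1-c) (*-nonNegℚ (ℚ.<⇒≤ 0<s) (square-nonNeg M)))

  0<mean : 0ℚ <ℚ mix c M N
  0<mean = subst (0ℚ <ℚ_) (sym (mix≡ M N)) (*-posℚ 0<s
    (ℚ.+-mono-<-≤ (*-posℚ (*-posℚ 0<N 0<N) (0<ι m)) (*-nonNegℚ (square-nonNeg M) (ℚ.<⇒≤ 0<N))))

  upper : ∀ q → 0ℚ ≤ℚ q → q ≤ℚ 1ℚ → ι k *ℚ mix c (φℚ k q m) (φℚ k q (suc m)) ≤ℚ a *ℚ mix c M N
  -- The factor `s` normalises the mixture and M + M is `ι k`. The mean weight is s (N² M + M² N) =
  -- s M N (N + M), which explains N (N + M) in `upper-even`.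
  upper q 0≤q q≤1 = subst₂ _≤ℚ_ left right
    (*-monoʳℚ (s *ℚ (M +ℚ M)) (*-nonNegℚ (ℚ.<⇒≤ 0<s) (ℚ.+-mono-≤ 0≤M 0≤M)) (upper-even n q 0≤q q≤1))
    where
    r : ℚ
    r = 1ℚ -ℚ q

    left : s *ℚ (M +ℚ M) *ℚ (q *ℚ q ^ n *ℚ r ^ n *ℚ weight q) ≡ ι k *ℚ mix c (φℚ k q m) (φℚ k q (suc m))
    left = trans
      (solve 7 (λ s M N Q R q r →
        s :* (M :+ M) :* (q :* Q :* R :* (N :* r :+ M :* M :* q))
        := (M :+ M) :* (s :* (N :* (q :* Q :* (r :* R)) :+ M :* M :* (q :* (q :* Q) :* R)))) refl
        s M (N *ℚ N) (q ^ n) (r ^ n) q r)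
      (cong₂ _*ℚ_ (sym (ι-2* m)) (trans
        (cong₂ (λ i j → s *ℚ (N *ℚ N *ℚ (q ^ m *ℚ r ^ i) +ℚ M *ℚ M *ℚ (q ^ suc m *ℚ r ^ j)))
          (sym k∸m) (sym k∸suc-m))
        (sym (mix≡ (φℚ k q m) (φℚ k q (suc m))))))
      where
      k∸m : k ∸ m ≡ m
      k∸m = trans (ℕ.m+n∸m≡n m (m ℕ.+ 0)) (ℕ.+-identityʳ m)
      k∸suc-m : k ∸ suc m ≡ n
      k∸suc-m = trans (sym (ℕ.pred[m∸n]≡m∸[1+n] k m)) (cong ℕ.pred k∸m)

    right : s *ℚ (M +ℚ M) *ℚ (A ^ m *ℚ (N *ℚ (N +ℚ M))) ≡ a *ℚ mix c M N
    right = trans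
      (solve 4 (λ s M N A → s :* (M :+ M) :* (A :* (N :* (N :+ M)))
        := (con 1ℚ :+ con 1ℚ) :* A :* (s :* (N :* N :* M :+ M :* M :* N))) refl s M N (A ^ m))
      (cong (a *ℚ_) (sym (mix≡ M N)))

odd-form : ∀ k → k % 2 ≡ 1 → k ≡ suc (2 ℕ.* (k / 2))
odd-form k eq = trans (m≡m%n+[m/n]*n k 2) (cong₂ ℕ._+_ eq (ℕ.*-comm (k / 2) 2))

even-form : ∀ k → k % 2 ≡ 0 → k ≡ 2 ℕ.* (k / 2)
even-form k eq = trans (m≡m%n+[m/n]*n k 2) (cong₂ ℕ._+_ eq (ℕ.*-comm (k / 2) 2))

-- With `m` a variable instead of `k / 2`, matching on the equation replaces `k` by its odd form
-- throughout.
odd-case : ∀ k .{{_ : NonZero k}} m → k ≡ suc (2 ℕ.* m) → 3 ≤ k →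
  α′ k ≡ α″ k × IsApproxRatio (top k) (fromℚ (α′ k))
odd-case _ zero    refl (s≤s ())
odd-case _ (suc n) refl _ =
  trans (α′≡A^m m) (sym (α″≡A^m m)) ,
  subst (λ a → IsApproxRatio (top (suc (2 ℕ.* m))) (fromℚ a)) (sym (α′≡A^m m)) (odd-ratio m)
  where
  m : ℕ
  m = suc n

even-case : ∀ k .{{_ : NonZero k}} m → k ≡ 2 ℕ.* m → 2 ≤ k →
  IsApproxRatio (top k) (fromℚ ((1ℚ +ℚ 1ℚ) *ℚ α′ (suc k)))
even-case _ zero    refl ()
even-case _ (suc n) refl _ =
  subst (λ a → IsApproxRatio (top (2 ℕ.* suc n)) (fromℚ ((1ℚ +ℚ 1ℚ) *ℚ a)))
    (sym (α′≡A^m (suc n))) (even-ratio n)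

theorem1p2 : (∀ k .{{_ : NonZero k}} → 3 ≤ k → k % 2 ≡ 1 →
    α′ k ≡ α″ k × IsApproxRatio (top k) (fromℚ (α′ k)))
    ×
    (∀ k .{{_ : NonZero k}} → 2 ≤ k → k % 2 ≡ 0 →
    IsApproxRatio (top k) (fromℚ ((1ℚ +ℚ 1ℚ) *ℚ α′ (suc k))))
theorem1p2 =
  (λ k 3≤k odd → odd-case k (k / 2) (odd-form k odd) 3≤k) ,
  (λ k 2≤k even → even-case k (k / 2) (even-form k even) 2≤k)
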